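{- Let $B$ be a constant. Restricted to instances in which the domain group $G$ has order $|G|\le B$, the problem HomExtSym can be solved in polynomial time.
   Context: Permutation groups are given by lists of generators (without loss of generality at most $2n$ generators for a subgroup of $S_n$). An instance of HomExtSym consists of a permutation group $G\le S_n$, a positive integer $m$, and a partial map $\gamma$ from $G$ to the symmetric group $S_m$, represented by listing its domain and its values on the domain. Put $M=\langle \operatorname{dom}\gamma\rangle\le G$. Standing assumption: $\gamma$ extends to a homomorphism $\psi: M\to S_m$; so the input is $\psi$, represented by its values on a set of generators of $M$. A solution is a homomorphism $\varphi: G\to S_m$ with $\varphi|_M=\psi$. Solving HomExtSym means deciding whether a solution exists (decision problem); the algorithmic results are also meant for the search problem: decide whether a solution exists and, if so, find one. A homomorphism $G\to S_m$ is represented by its values on a set of generators of $G$. Polynomial time means time polynomial in $n$ and $m$. -}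

module Defs where

open import Algebra.Bundles using (Group)
open import Algebra.Morphism.Bundles using (GroupHomomorphism)
open import Data.Fin.Base using (Fin; zero; toℕ)
open import Data.Fin.Permutation
  using (Permutation′; _≈_; _∘ₚ_; flip; id; _⟨$⟩ʳ_; inverseˡ; inverseʳ)
open import Data.List.Base using (List; allFin; foldr; length; map)
open import Data.List.Membership.Propositional using (_∈_; mapWith∈)
open import Data.List.Membership.Propositional.Properties using (∈-map⁺)
open import Data.List.Relation.Unary.All using (All; lookup)
open import Data.List.Relation.Unary.All.Properties using (map⁺)
open import Data.List.Relation.Unary.Unique.Setoid using (Unique)
open import Data.Nat.Base using (ℕ; suc; _+_; _*_; _^_; _≤_; NonZero)
open import Data.Product.Base using (Σ; Σ-syntax; ∃-syntax; _×_; _,_; proj₁; proj₂)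
open import Data.Sum.Base using (_⊎_)
open import Data.Vec.Base as Vec using (Vec; _[_]≔_)
open import Function.Bundles using (Inverse)
open import Level using (0ℓ)
open import Relation.Binary.PropositionalEquality
  using (_≡_; refl; sym; trans; cong; setoid)
open import Relation.Nullary using (¬_)

------------------------------------------------------------------------
-- Model of computation: the language WHILE on binary trees, with its
-- standard unit-cost time measure (N. D. Jones, Computability and
-- Complexity from a Programming Perspective, 1997).  Each elementary
-- operation takes constant time on pointers to shared, immutable cells,
-- as trees are inspected only by following pointers and testing for nil.
-- So on inputs and outputs of polynomial size polynomial time here
-- agrees with polynomial time on Turing machines.

infixr 5 _∙_

data Tree : Set where
  nil : Tree
  _∙_ : Tree → Tree → Tree

head tail : Tree → Tree
head nil     = nil
head (s ∙ _) = s
tail nil     = nil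
tail (_ ∙ t) = t

Store : ℕ → Set
Store k = Vec Tree k

data Expr (k : ℕ) : Set where
  var   : Fin k → Expr k
  quot  : Tree → Expr k
  cons  : Expr k → Expr k → Expr k
  hd tl : Expr k → Expr k

⟦_⟧ : ∀ {k} → Expr k → Store k → Tree
⟦ var x ⟧    σ = Vec.lookup σ x
⟦ quot t ⟧   σ = t
⟦ cons e f ⟧ σ = ⟦ e ⟧ σ ∙ ⟦ f ⟧ σ
⟦ hd e ⟧     σ = head (⟦ e ⟧ σ)
⟦ tl e ⟧     σ = tail (⟦ e ⟧ σ)

cost : ∀ {k} → Expr k → ℕ
cost (var _)    = 1
cost (quot _)   = 1
cost (cons e f) = 1 + cost e + cost f
cost (hd e)     = 1 + cost e
cost (tl e)     = 1 + cost e

infix  5 _≔_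
infixr 4 _⨾_

data Cmd (k : ℕ) : Set where
  _≔_           : Fin k → Expr k → Cmd k
  _⨾_           : Cmd k → Cmd k → Cmd k
  if_then_else_ : Expr k → Cmd k → Cmd k → Cmd k
  while_repeat_     : Expr k → Cmd k → Cmd k

-- ⟨ c , σ ⟩⇓ σ′ # t : command c started in store σ halts in store σ′ after
-- exactly t time units.  The tree nil is false, every other tree is true.

infix 3 ⟨_,_⟩⇓_#_

data ⟨_,_⟩⇓_#_ {k : ℕ} : Cmd k → Store k → Store k → ℕ → Set where
  assign      : ∀ {x e σ} →
                ⟨ x ≔ e , σ ⟩⇓ σ [ x ]≔ ⟦ e ⟧ σ # 1 + cost e
  seq         : ∀ {c d σ σ′ σ″ s t} →
                ⟨ c , σ ⟩⇓ σ′ # s → ⟨ d , σ′ ⟩⇓ σ″ # t →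
                ⟨ c ⨾ d , σ ⟩⇓ σ″ # s + t
  if-true     : ∀ {e c d σ σ′ u v t} → ⟦ e ⟧ σ ≡ u ∙ v →
                ⟨ c , σ ⟩⇓ σ′ # t →
                ⟨ if e then c else d , σ ⟩⇓ σ′ # 1 + cost e + t
  if-false    : ∀ {e c d σ σ′ t} → ⟦ e ⟧ σ ≡ nil →
                ⟨ d , σ ⟩⇓ σ′ # t →
                ⟨ if e then c else d , σ ⟩⇓ σ′ # 1 + cost e + t
  while-false : ∀ {e c σ} → ⟦ e ⟧ σ ≡ nil →
                ⟨ while e repeat c , σ ⟩⇓ σ # 1 + cost e
  while-true  : ∀ {e c σ σ′ σ″ u v s t} → ⟦ e ⟧ σ ≡ u ∙ v →
                ⟨ c , σ ⟩⇓ σ′ # s → ⟨ while e repeat c , σ′ ⟩⇓ σ″ # t →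
                ⟨ while e repeat c , σ ⟩⇓ σ″ # 1 + cost e + s + t

-- Variable zero holds the input at the start and the output at the end;
-- the auxiliary variables start as nil.

record Program : Set where
  field
    auxiliaries : ℕ
    body        : Cmd (suc auxiliaries)

_maps_to_inTime_ : Program → Tree → Tree → ℕ → Set
p maps input to output inTime t =
  Σ[ σ ∈ Store (suc auxiliaries) ]
    (⟨ body , input Vec.∷ Vec.replicate auxiliaries nil ⟩⇓ σ # t)
    × Vec.lookup σ zero ≡ output
  where open Program p

------------------------------------------------------------------------
-- Search problems and polynomial time

-- size is the parameter in which running time is measured, not the length
-- of the encoding.
record SearchProblem : Set₁ where
  field
    Instance       : Set
    Solution       : Instance → Set
    size           : Instance → ℕ
    encode         : Instance → Tree
    encodeSolution : ∀ I → Solution I → Tree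

  -- An output is nil exactly when it reports that there is no solution, so
  -- a correct output settles the decision problem as well.
  Correct : Instance → Tree → Set
  Correct I out =
    (out ≡ nil × ¬ Solution I)
    ⊎ (Σ[ s ∈ Solution I ] out ≡ nil ∙ encodeSolution I s)

_restrictedTo_ : (P : SearchProblem) → (SearchProblem.Instance P → Set) →
                 SearchProblem
P restrictedTo Q = record
  { Instance       = Σ Instance Q
  ; Solution       = λ I → Solution (proj₁ I)
  ; size           = λ I → size (proj₁ I)
  ; encode         = λ I → encode (proj₁ I)
  ; encodeSolution = λ I → encodeSolution (proj₁ I)
  }
  where open SearchProblem P

-- The program and the bound are uniform in the instance.  For sizes ≥ 1 the
-- bounds c * size ^ d dominate every polynomial in the size.
SolvableInPolynomialTime : SearchProblem → Set
SolvableInPolynomialTime P =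
  Σ[ p ∈ Program ] ∃[ c ] ∃[ d ] (∀ (I : Instance) →
    ∃[ out ] ∃[ t ] (p maps encode I to out inTime t)
                    × t ≤ c * size I ^ d
                    × Correct I out)
  where open SearchProblem P

------------------------------------------------------------------------
-- Permutation groups

Perm : ℕ → Set
Perm = Permutation′

-- The product π ∘ₚ ρ applies π first.
Sym : ℕ → Group 0ℓ 0ℓ
Sym n = record
  { Carrier = Perm n
  ; _≈_     = _≈_
  ; _∙_     = _∘ₚ_
  ; ε       = id
  ; _⁻¹     = flip
  ; isGroup = record
    { isMonoid = record
      { isSemigroup = record
        { isMagma = record
          { isEquivalence = record
            { refl  = λ _ → refl
            ; sym   = λ p i → sym (p i)
            ; trans = λ p q i → trans (p i) (q i)
            }
          ; ∙-cong = λ {_} {π} {ρ} p q i →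
              trans (cong (ρ ⟨$⟩ʳ_) (p i)) (q (π ⟨$⟩ʳ i))
          }
        ; assoc = λ _ _ _ _ → refl
        }
      ; identity = (λ _ _ → refl) , (λ _ _ → refl)
      }
    ; inverse = (λ π _ → inverseʳ π) , (λ π _ → inverseˡ π)
    ; ⁻¹-cong = λ {π} {ρ} p i →
        trans (cong (flip π ⟨$⟩ʳ_) (sym (inverseʳ ρ)))
       (trans (cong (flip π ⟨$⟩ʳ_) (sym (p (flip ρ ⟨$⟩ʳ i))))
              (inverseˡ π))
    }
  }

module _ {n : ℕ} where
  infix 4 _∈⟨_⟩

  -- Closure under _≈_ is needed because permutations that agree pointwise
  -- need not be propositionally equal.
  data _∈⟨_⟩ (π : Perm n) (gs : List (Perm n)) : Set where
    gen  : π ∈ gs → π ∈⟨ gs ⟩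
    one  : π ≈ id → π ∈⟨ gs ⟩
    mul  : ∀ {ρ τ} → ρ ∈⟨ gs ⟩ → τ ∈⟨ gs ⟩ → π ≈ ρ ∘ₚ τ → π ∈⟨ gs ⟩
    inv  : ∀ {ρ} → ρ ∈⟨ gs ⟩ → π ≈ flip ρ → π ∈⟨ gs ⟩

  ∈⟨⟩-mono : ∀ {gs hs π} → All (_∈⟨ gs ⟩) hs → π ∈⟨ hs ⟩ → π ∈⟨ gs ⟩
  ∈⟨⟩-mono hs⊆ (gen π∈)    = lookup hs⊆ π∈
  ∈⟨⟩-mono hs⊆ (one p)     = one p
  ∈⟨⟩-mono hs⊆ (mul x y p) = mul (∈⟨⟩-mono hs⊆ x) (∈⟨⟩-mono hs⊆ y) p
  ∈⟨⟩-mono hs⊆ (inv x p)   = inv (∈⟨⟩-mono hs⊆ x) p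

  ⟨_⟩ : List (Perm n) → Group 0ℓ 0ℓ
  ⟨ gs ⟩ = record
    { Carrier = Σ (Perm n) (_∈⟨ gs ⟩)
    ; _≈_     = λ x y → proj₁ x S.≈ proj₁ y
    ; _∙_     = λ x y → proj₁ x ∘ₚ proj₁ y , mul (proj₂ x) (proj₂ y) (λ _ → refl)
    ; ε       = id , one (λ _ → refl)
    ; _⁻¹     = λ x → flip (proj₁ x) , inv (proj₂ x) (λ _ → refl)
    ; isGroup = record
      { isMonoid = record
        { isSemigroup = record
          { isMagma = record
            { isEquivalence = record
              { refl  = λ {x} → S.refl {proj₁ x}
              ; sym   = λ {x} {y} → S.sym {proj₁ x} {proj₁ y}
              ; trans = λ {x} {y} {z} → S.trans {proj₁ x} {proj₁ y} {proj₁ z}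
              }
            ; ∙-cong = λ {x} {y} {u} {v} →
                S.∙-cong {proj₁ x} {proj₁ y} {proj₁ u} {proj₁ v}
            }
          ; assoc = λ x y z → S.assoc (proj₁ x) (proj₁ y) (proj₁ z)
          }
        ; identity = (λ x → S.identityˡ (proj₁ x)) , (λ x → S.identityʳ (proj₁ x))
        }
      ; inverse = (λ x → S.inverseˡ (proj₁ x)) , (λ x → S.inverseʳ (proj₁ x))
      ; ⁻¹-cong = λ {x} {y} → S.⁻¹-cong {proj₁ x} {proj₁ y}
      }
    }
    where module S = Group (Sym n)

Hom : Group 0ℓ 0ℓ → Group 0ℓ 0ℓ → Set
Hom G H = GroupHomomorphism (Group.rawGroup G) (Group.rawGroup H)

HasOrder : Group 0ℓ 0ℓ → ℕ → Set
HasOrder G k = Inverse (Group.setoid G) (setoid (Fin k))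

------------------------------------------------------------------------
-- Homomorphism extension

record HomExtSymInstance : Set where
  field
    n m        : ℕ
    m-positive : NonZero m
    gens       : List (Perm n)
    few-gens   : length gens ≤ 2 * n

  G : Group 0ℓ 0ℓ
  G = ⟨ gens ⟩

  field
    -- The graph of the partial map, each element of its domain listed once.
    γ          : List (Perm n × Perm m)
    γ-unique   : Unique (Group.setoid (Sym n)) (map proj₁ γ)
    domγ⊆G     : All (λ xy → proj₁ xy ∈⟨ gens ⟩) γ

  domγ : List (Perm n)
  domγ = map proj₁ γ

  M : Group 0ℓ 0ℓ
  M = ⟨ domγ ⟩

  inclusion : Group.Carrier M → Group.Carrier G
  inclusion (x , x∈M) = x , ∈⟨⟩-mono (map⁺ domγ⊆G) x∈M

  field
    ψ          : Hom M (Sym m)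
    ψ-extendsγ : ∀ {x y} (xy∈γ : (x , y) ∈ γ) →
                 GroupHomomorphism.⟦_⟧ ψ (x , gen (∈-map⁺ proj₁ xy∈γ)) ≈ y

record HomExtSymSolution (I : HomExtSymInstance) : Set where
  open HomExtSymInstance I
  field
    φ       : Hom G (Sym m)
    φ|M≈ψ   : ∀ x → GroupHomomorphism.⟦_⟧ φ (inclusion x)
                    ≈ GroupHomomorphism.⟦_⟧ ψ x

encodeℕ : ℕ → Tree
encodeℕ 0       = nil
encodeℕ (suc k) = nil ∙ encodeℕ k

encodeList : {A : Set} → (A → Tree) → List A → Tree
encodeList f = foldr (λ x t → f x ∙ t) nil

encodePerm : ∀ {n} → Perm n → Tree
encodePerm {n} π = encodeList (λ i → encodeℕ (toℕ (π ⟨$⟩ʳ i))) (allFin n)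

HomExtSym : SearchProblem
HomExtSym = record
  { Instance       = HomExtSymInstance
  ; Solution       = HomExtSymSolution
  -- m is positive, so this is at least 1, and polynomially bounded in n + m
  -- is the same as polynomially bounded in n and m.
  ; size           = λ I → let open HomExtSymInstance I in n + m
  ; encode         = λ I → let open HomExtSymInstance I in
      encodeℕ n ∙ encodeℕ m ∙ encodeList encodePerm gens
      ∙ encodeList (λ (x , y) → encodePerm x ∙ encodePerm y) γ
  -- The values of φ on the given generators of G, in the given order.
  ; encodeSolution = λ I s →
      let open HomExtSymInstance I
          open HomExtSymSolution s
      in encodeList encodePerm
           (mapWith∈ gens (λ {g} g∈ → GroupHomomorphism.⟦_⟧ φ (g , gen g∈)))
  }

GroupOrderAtMost : ℕ → HomExtSymInstance → Set
GroupOrderAtMost B I = ∃[ k ] HasOrder (HomExtSymInstance.G I) k × k ≤ B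

{-# OPTIONS --safe #-}

-- A solution is an action of G on the m points extending the given action of M.
-- Listing the k ≤ B elements of G identifies G with a group on Fin k.  Each orbit is
-- then the image of a map e : Fin k → Fin m, a ↦ p · a, and its type is the kernel
-- of e; there are at most k ^ k types.  So it suffices to try all multiplicities
-- ≤ m of the types, placing the orbits one after another: a block e is found by
-- trying all m ^ k maps, and any choice that is M-equivariant and has the right
-- kernel is as good as any other.  Indeed, if an action has an orbit e and f is
-- another M-equivariant map with the same kernel, then e a ↦ f a extends to an
-- M-equivariant permutation of the points, and conjugation by it turns e into f.
--
-- The program is written in a combinator language whose only loop runs N times, for
-- one N linear in n + m; a term of that language runs in time polynomial in N.
module Submission where

open import Defs
open import Algebra.Bundles using (Group)
open import Algebra.Morphism.Bundles using (GroupHomomorphism)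
open import Algebra.Structures using (IsGroup)
open import Data.Empty using (⊥-elim)
open import Data.Fin.Base using (Fin; zero; suc; toℕ)
open import Data.Fin.Permutation
  using (_⟨$⟩ʳ_; _⟨$⟩ˡ_; _≈_; _∘ₚ_; flip; inverseˡ; inverseʳ; permutation)
  renaming (id to idₚ)
open import Data.Fin.Properties
  using (all?; any?; pigeonhole; injective⇒≤; toℕ<n; toℕ-injective; toℕ≤pred[n])
  renaming (_≟_ to _≟ᶠ_)
open import Data.List.Base
  using (List; []; _∷_; foldl; foldr; length; lookup; map; replicate; tabulate;
         allFin; cartesianProduct; reverse; _ʳ++_)
open import Data.List.Membership.Propositional using (_∈_; find; lose; mapWith∈)
open import Data.List.Membership.Propositional.Properties using (∈-lookup; ∈-map⁺; ∈-map⁻)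
open import Data.List.Properties
  using (length-map; length-tabulate; length-replicate; length-reverse; map-∘; map-tabulate;
         tabulate-lookup; reverse-involutive; ∷-injectiveˡ; ∷-injectiveʳ)
open import Data.List.Relation.Unary.All as All using (All; []; _∷_)
open import Data.List.Relation.Unary.All.Properties as All using (¬Any⇒All¬)
open import Data.List.Relation.Unary.AllPairs using ([]; _∷_)
open import Data.List.Relation.Unary.Any as Any using (Any; here; there)
open import Data.List.Relation.Unary.Any.Properties as Any
  using (cartesianProduct⁺; lookup-index; tabulate⁺; tabulate⁻; ¬Any[])
open import Data.List.Relation.Unary.Unique.Setoid using (Unique)
open import Data.Nat.Base
  using (ℕ; zero; suc; _+_; _*_; _^_; _∸_; _≤_; _<_; z≤n; s≤s; NonZero; >-nonZero; >-nonZero⁻¹)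
open import Data.Nat.Properties
  using (≤-refl; ≤-reflexive; ≤-trans; ≤-antisym; <⇒≤; ≤⇒≯; ≮⇒≥; n≤1+n; m≤m+n; m≤n+m; m≤m*n;
         m+n≤o⇒n≤o; +-comm; +-identityʳ; +-suc; +-mono-≤; +-monoʳ-≤; *-assoc; *-comm; *-identityˡ;
         *-identityʳ; *-distribʳ-+; *-mono-≤; *-monoʳ-≤; [m*n]*[o*p]≡[m*o]*[n*p]; ^-distribˡ-+-*;
         ^-monoˡ-≤; ^-monoʳ-≤; m∸n≡0⇒m≤n; n∸n≡0; 0∸n≡0; module ≤-Reasoning)
open import Data.Nat.Tactic.RingSolver using (solve-∀)
open import Data.Product.Base using (∃-syntax; _×_; _,_; proj₁; proj₂)
open import Data.Sum.Base using (inj₁; inj₂)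
open import Data.Vec.Base using ([]; _∷_)
open import Function.Base using (_∘_; id)
open import Function.Bundles using (Injection)
open import Function.Properties.Inverse using (Inverse⇒Injection)
open import Relation.Binary.PropositionalEquality
open import Relation.Nullary using (¬_; Dec; yes; no; ¬?; contradiction)
open import Relation.Nullary.Decidable using (decidable-stable)

-- Programs with bounded iteration

-- Only the multiplicities are backtracked over: a block once placed is never revised. This keeps
-- the nesting depth of the loops a function of k, whereas trying all placements of up to m orbits
-- would not be polynomial. Completeness rests on the invariant `Extends s cs`: some action contains
-- the blocks s, and every point outside them has a type in cs. A failed search refutes it. The
-- images of e and f may overlap, so that swapping e a with f a is not even a map; hence `exchange`
-- follows chains of points instead. Values are prescribed on the domain of γ only, since
-- homomorphisms that agree on generators of M agree on M. Likewise G enters as a list of distinct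
-- permutations closed under right multiplication by the generators, and all group laws on its
-- positions are inherited from permutations. The length of that list selects at run time one of B +
-- 1 searches, each built for a fixed order.

infixr 6 _⊙_
infixr 5 _&_

data Tm : Set where
  this    : Tm
  const   : Tree → Tm
  _&_     : Tm → Tm → Tm
  fst snd : Tm
  _⊙_     : Tm → Tm → Tm
  cond    : Tm → Tm → Tm → Tm
  iter    : Tm → Tm

iterate : {A : Set} → (A → A) → ℕ → A → A
iterate f zero    x = x
iterate f (suc j) x = iterate f j (f x)

iterate-suc : {A : Set} (f : A → A) (j : ℕ) (x : A) → iterate f (suc j) x ≡ f (iterate f j x)
iterate-suc f zero    x = refl
iterate-suc f (suc j) x = iterate-suc f j (f x)

choose : Tree → Tree → Tree → Tree
choose nil     s t = t
choose (_ ∙ _) s t = s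

eval : ℕ → Tm → Tree → Tree
eval N this         x = x
eval N (const t)    x = t
eval N (e & f)    x = eval N e x ∙ eval N f x
eval N fst          x = head x
eval N snd          x = tail x
eval N (e ⊙ f)      x = eval N e (eval N f x)
eval N (cond e f g) x = choose (eval N e x) (eval N f x) (eval N g x)
eval N (iter e)     x = iterate (eval N e) N x

-- Polynomial bounds

data Polynomial (f : ℕ → ℕ) : Set where
  poly : ∀ c d → (∀ N → .{{NonZero N}} → f N ≤ c * N ^ d) → Polynomial f

private
  ^-grow : ∀ N d e → .{{NonZero N}} → N ^ d ≤ N ^ (d + e)
  ^-grow N d e = ^-monoʳ-≤ N (m≤m+n d e)

poly-const : ∀ k → Polynomial (λ _ → k)
poly-const k = poly k 0 λ N → ≤-reflexive (sym (*-identityʳ k))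

poly-id : Polynomial (λ N → N)
poly-id = poly 1 1 λ N → ≤-reflexive (sym (trans (*-identityˡ (N ^ 1)) (*-identityʳ N)))

-- d + d′ serves as a common exponent of both summands. This is where N = 0 has to be excluded: a
-- higher power dominates a lower one only for N at least 1.
poly-+ : ∀ {f g} → Polynomial f → Polynomial g → Polynomial (λ N → f N + g N)
poly-+ (poly c d p) (poly c′ d′ q) = poly (c + c′) (d + d′) λ N → begin
  _                                       ≤⟨ +-mono-≤ (p N) (q N) ⟩
  c * N ^ d + c′ * N ^ d′                 ≤⟨ +-mono-≤ (*-monoʳ-≤ c (^-grow N d d′))
                                               (*-monoʳ-≤ c′ (^-grow N d′ d)) ⟩
  c * N ^ (d + d′) + c′ * N ^ (d′ + d)    ≡⟨ cong (λ z → c * N ^ (d + d′) + c′ * N ^ z) (+-comm d′ d) ⟩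
  c * N ^ (d + d′) + c′ * N ^ (d + d′)    ≡⟨ *-distribʳ-+ (N ^ (d + d′)) c c′ ⟨
  (c + c′) * N ^ (d + d′)                 ∎
  where open ≤-Reasoning

poly-* : ∀ {f g} → Polynomial f → Polynomial g → Polynomial (λ N → f N * g N)
poly-* (poly c d p) (poly c′ d′ q) = poly (c * c′) (d + d′) λ N → begin
  _                               ≤⟨ *-mono-≤ (p N) (q N) ⟩
  (c * N ^ d) * (c′ * N ^ d′)     ≡⟨ [m*n]*[o*p]≡[m*o]*[n*p] c (N ^ d) c′ (N ^ d′) ⟩
  (c * c′) * (N ^ d * N ^ d′)     ≡⟨ cong (c * c′ *_) (^-distribˡ-+-* N d d′) ⟨
  (c * c′) * N ^ (d + d′)         ∎
  where open ≤-Reasoning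

-- Translation into WHILE and its running time

-- X holds the current value, S a stack of saved values, C the number of iterations.
X S C : Fin 3
X = zero
S = suc zero
C = suc (suc zero)

compile : Tm → Cmd 3
compile this         = X ≔ var X
compile (const t)    = X ≔ quot t
compile (e & f)    =
  S ≔ cons (var X) (var S) ⨾ compile e ⨾
  S ≔ cons (var X) (var S) ⨾ X ≔ hd (tl (var S)) ⨾ compile f ⨾
  X ≔ cons (hd (var S)) (var X) ⨾ S ≔ tl (tl (var S))
compile fst          = X ≔ hd (var X)
compile snd          = X ≔ tl (var X)
compile (e ⊙ f)      = compile f ⨾ compile e
compile (cond e f g) =
  S ≔ cons (var X) (var S) ⨾ compile e ⨾
  S ≔ cons (var X) (var S) ⨾ X ≔ hd (tl (var S)) ⨾
  if hd (var S) then (S ≔ tl (tl (var S)) ⨾ compile f)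
                else (S ≔ tl (tl (var S)) ⨾ compile g)
compile (iter e)     =
  -- The loop counts down a copy of C on the stack, so nested loops do not disturb each other and C
  -- stays intact.
  S ≔ cons (var C) (var S) ⨾
  while hd (var S) repeat (S ≔ cons (tl (hd (var S))) (tl (var S)) ⨾ compile e) ⨾
  S ≔ tl (var S)

-- Depends on the clock N alone and not on the size of the trees: operations have unit cost and
-- every loop runs exactly N rounds. A conditional is charged for both branches.
bound : Tm → ℕ → ℕ
bound this         N = 2
bound (const t)    N = 2
bound (e & f)    N = 21 + (bound e N + bound f N)
bound fst          N = 3
bound snd          N = 3
bound (e ⊙ f)      N = bound f N + bound e N
bound (cond e f g) N = 19 + (bound e N + (bound f N + bound g N))
bound (iter e)     N = 11 + N * (10 + bound e N)

bound-polynomial : ∀ e → Polynomial (bound e)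
bound-polynomial this         = poly-const 2
bound-polynomial (const t)    = poly-const 2
bound-polynomial (e & f)    =
  poly-+ (poly-const 21) (poly-+ (bound-polynomial e) (bound-polynomial f))
bound-polynomial fst          = poly-const 3
bound-polynomial snd          = poly-const 3
bound-polynomial (e ⊙ f)      = poly-+ (bound-polynomial f) (bound-polynomial e)
bound-polynomial (cond e f g) =
  poly-+ (poly-const 19) (poly-+ (bound-polynomial e)
    (poly-+ (bound-polynomial f) (bound-polynomial g)))
bound-polynomial (iter e)     =
  poly-+ (poly-const 11) (poly-* poly-id (poly-+ (poly-const 10) (bound-polynomial e)))

Halts : ∀ {k} → Cmd k → Store k → Store k → ℕ → Set
Halts c σ σ′ b = ∃[ t ] (⟨ c , σ ⟩⇓ σ′ # t) × t ≤ b

infixr 4 _then_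

_then_ : ∀ {k} {c d : Cmd k} {σ σ′ σ″ a b} →
  Halts c σ σ′ a → Halts d σ′ σ″ b → Halts (c ⨾ d) σ σ″ (a + b)
(s , p , s≤a) then (t , q , t≤b) = s + t , seq p q , +-mono-≤ s≤a t≤b

set : ∀ {k} {x : Fin k} {e σ} → Halts (x ≔ e) σ _ (1 + cost e)
set = _ , assign , ≤-refl

weaken : ∀ {k} {c : Cmd k} {σ σ′ a b} → a ≤ b → Halts c σ σ′ a → Halts c σ σ′ b
weaken a≤b (t , p , t≤a) = t , p , ≤-trans t≤a a≤b

-- Stack and counter are restored for an arbitrary stack s; the induction needs this because
-- subterms run on top of values saved by the enclosing term.
compile-correct : ∀ N e x s →
  Halts (compile e) (x ∷ s ∷ encodeℕ N ∷ []) (eval N e x ∷ s ∷ encodeℕ N ∷ []) (bound e N)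
compile-correct N this         x s = set
compile-correct N (const t)    x s = set
compile-correct N (e & f)      x s = weaken (≤-reflexive (eq (bound e N) (bound f N)))
  (set then compile-correct N e x _ then set then set then
   compile-correct N f x _ then set then set)
  where
  eq : ∀ a b → 4 + (a + (4 + (4 + (b + (5 + 4))))) ≡ 21 + (a + b)
  eq = solve-∀
compile-correct N fst          x s = set
compile-correct N snd          x s = set
compile-correct N (e ⊙ f)      x s = compile-correct N f x s then compile-correct N e _ s
compile-correct N (cond e f g) x s = weaken (≤-reflexive (eq (bound e N) (bound f N + bound g N)))
  (set then compile-correct N e x _ then set then set then branch)
  where
  eq : ∀ a b → 4 + (a + (4 + (4 + (7 + b)))) ≡ 19 + (a + b)
  eq = solve-∀
  branch : Halts (if hd (var S) then (S ≔ tl (tl (var S)) ⨾ compile f)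
                                else (S ≔ tl (tl (var S)) ⨾ compile g))
    (x ∷ (eval N e x ∙ x ∙ s) ∷ encodeℕ N ∷ [])
    (eval N (cond e f g) x ∷ s ∷ encodeℕ N ∷ []) (7 + (bound f N + bound g N))
  branch with eval N e x
  ... | nil   = let t , p , t≤ = set then compile-correct N g x s in
    _ , if-false refl p , +-monoʳ-≤ 3 (≤-trans t≤ (+-monoʳ-≤ 4 (m≤n+m _ _)))
  ... | _ ∙ _ = let t , p , t≤ = set then compile-correct N f x s in
    _ , if-true refl p , +-monoʳ-≤ 3 (≤-trans t≤ (+-monoʳ-≤ 4 (m≤m+n _ _)))
compile-correct N (iter e)     x s = weaken (≤-reflexive (eq (N * (10 + bound e N))))
  (set then loop N x then set)
  where
  eq : ∀ a → 4 + (4 + a + 3) ≡ 11 + a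
  eq = solve-∀
  step : Cmd 3
  step = S ≔ cons (tl (hd (var S))) (tl (var S)) ⨾ compile e
  loop : ∀ j x → Halts (while hd (var S) repeat step)
    (x ∷ (encodeℕ j ∙ s) ∷ encodeℕ N ∷ [])
    (iterate (eval N e) j x ∷ (nil ∙ s) ∷ encodeℕ N ∷ []) (4 + j * (10 + bound e N))
  loop zero    x = _ , while-false refl , s≤s (s≤s (s≤s z≤n))
  loop (suc j) x =
    let t , p , t≤ = set then compile-correct N e x (encodeℕ j ∙ s)
        u , q , u≤ = loop j (eval N e x)
    in _ , while-true refl p q ,
       ≤-trans (+-mono-≤ (+-monoʳ-≤ 3 t≤) u≤)
               (≤-reflexive (eq′ (bound e N) (j * (10 + bound e N))))
    where
    eq′ : ∀ a b → 3 + (7 + a) + (4 + b) ≡ 4 + (10 + a + b)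
    eq′ = solve-∀

-- The clock, computed from the input

^-distribʳ-* : ∀ d m n → (m * n) ^ d ≡ m ^ d * n ^ d
^-distribʳ-* zero    m n = refl
^-distribʳ-* (suc d) m n = trans (cong (m * n *_) (^-distribʳ-* d m n))
                                 ([m*n]*[o*p]≡[m*o]*[n*p] m n (m ^ d) (n ^ d))

-- At least B and 2n, and more than m if B > 0: no list in the algorithm is longer.
fuel : ℕ → ℕ → ℕ → ℕ
fuel B n m = m + (n * 2 + B)

program : ℕ → Tm → Program
program B e = record
  { auxiliaries = 2
  ; body        =
      C ≔ quot (encodeℕ B) ⨾
      S ≔ hd (var X) ⨾
      while var S repeat (C ≔ cons (quot nil) (cons (quot nil) (var C)) ⨾ S ≔ tl (var S)) ⨾
      S ≔ hd (tl (var X)) ⨾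
      while var S repeat (C ≔ cons (quot nil) (var C) ⨾ S ≔ tl (var S)) ⨾
      compile e
  }

program-correct : ∀ B e → ∃[ c ] ∃[ d ] ∀ n m r → .{{NonZero m}} →
  let input = encodeℕ n ∙ encodeℕ m ∙ r in
  ∃[ t ] (program B e maps input to eval (fuel B n m) e input inTime t)
       × t ≤ c * (n + m) ^ d
program-correct B e =
  go (poly-+ (poly-+ (poly-const 13) (poly-* (poly-const 22) poly-id)) (bound-polynomial e))
  where
  open ≤-Reasoning
  double : ∀ x n c → Halts
    (while var S repeat (C ≔ cons (quot nil) (cons (quot nil) (var C)) ⨾ S ≔ tl (var S)))
    (x ∷ encodeℕ n ∷ encodeℕ c ∷ []) (x ∷ nil ∷ encodeℕ (n * 2 + c) ∷ []) (2 + n * 11)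
  double x zero    c = _ , while-false refl , ≤-refl
  double x (suc n) c with double x n (2 + c)
  ... | u , q , u≤ rewrite +-suc (n * 2) (suc c) | +-suc (n * 2) c =
    let t , p , t≤ = set then set
    in _ , while-true refl p q ,
       ≤-trans (+-mono-≤ (+-monoʳ-≤ 2 t≤) u≤) (≤-reflexive (eq (n * 11)))
    where
    eq : ∀ a → 2 + 9 + (2 + a) ≡ 2 + (11 + a)
    eq = solve-∀
  single : ∀ x n c → Halts
    (while var S repeat (C ≔ cons (quot nil) (var C) ⨾ S ≔ tl (var S)))
    (x ∷ encodeℕ n ∷ encodeℕ c ∷ []) (x ∷ nil ∷ encodeℕ (n + c) ∷ []) (2 + n * 9)
  single x zero    c = _ , while-false refl , ≤-refl
  single x (suc n) c with single x n (suc c)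
  ... | u , q , u≤ rewrite +-suc n c =
    let t , p , t≤ = set then set
    in _ , while-true refl p q ,
       ≤-trans (+-mono-≤ (+-monoʳ-≤ 2 t≤) u≤) (≤-reflexive (eq (n * 9)))
    where
    eq : ∀ a → 2 + 7 + (2 + a) ≡ 2 + (9 + a)
    eq = solve-∀
  time : ∀ n m b → 2 + (3 + (2 + n * 11 + (4 + (2 + m * 9 + b)))) ≤ 13 + 22 * fuel B n m + b
  time n m b = begin
    2 + (3 + (2 + n * 11 + (4 + (2 + m * 9 + b)))) ≤⟨ m≤m+n _ (11 * n + 13 * m + 22 * B + 22 * n) ⟩
    2 + (3 + (2 + n * 11 + (4 + (2 + m * 9 + b)))) + (11 * n + 13 * m + 22 * B + 22 * n)
      ≡⟨ eq n m B b ⟩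
    13 + 22 * fuel B n m + b ∎
    where
    eq : ∀ n m B b → 2 + (3 + (2 + n * 11 + (4 + (2 + m * 9 + b)))) + (11 * n + 13 * m + 22 * B + 22 * n)
       ≡ 13 + 22 * (m + (n * 2 + B)) + b
    eq = solve-∀
  -- Since m is positive, the constant B is absorbed into B * (n + m); this turns a bound in the
  -- clock into one in n + m.
  size : ∀ n m → .{{NonZero m}} → fuel B n m ≤ (2 + B) * (n + m)
  size n (suc m) = begin
    suc m + (n * 2 + B) ≤⟨ m≤m+n _ (suc m + B * (n + m)) ⟩
    suc m + (n * 2 + B) + (suc m + B * (n + m)) ≡⟨ eq n m B ⟩
    (2 + B) * (n + suc m) ∎
    where
    eq : ∀ n m B → suc m + (n * 2 + B) + (suc m + B * (n + m)) ≡ (2 + B) * (n + suc m)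
    eq = solve-∀
  halts : ∀ n m r → let N = fuel B n m ; x = encodeℕ n ∙ encodeℕ m ∙ r in
    Halts (Program.body (program B e)) (x ∷ nil ∷ nil ∷ []) (eval N e x ∷ nil ∷ encodeℕ N ∷ [])
      (2 + (3 + (2 + n * 11 + (4 + (2 + m * 9 + bound e N)))))
  halts n m r = set then set then double x n B then set then single x m (n * 2 + B) then
    compile-correct (fuel B n m) e x nil
    where x = encodeℕ n ∙ encodeℕ m ∙ r
  Bounded : ℕ → ℕ → Set
  Bounded c d = ∀ n m r → .{{NonZero m}} →
    let input = encodeℕ n ∙ encodeℕ m ∙ r in
    ∃[ t ] (program B e maps input to eval (fuel B n m) e input inTime t)
         × t ≤ c * (n + m) ^ d
  go : Polynomial (λ N → 13 + 22 * N + bound e N) → ∃[ c ] ∃[ d ] Bounded c d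
  go (poly c d p) = c * (2 + B) ^ d , d , run
    where
    total : ∀ n m → .{{NonZero m}} →
      2 + (3 + (2 + n * 11 + (4 + (2 + m * 9 + bound e (fuel B n m))))) ≤ c * (2 + B) ^ d * (n + m) ^ d
    total n m = begin
      _                                   ≤⟨ time n m (bound e N) ⟩
      13 + 22 * N + bound e N             ≤⟨ p N ⟩
      c * N ^ d                           ≤⟨ *-monoʳ-≤ c (^-monoˡ-≤ d (size n m)) ⟩
      c * ((2 + B) * (n + m)) ^ d         ≡⟨ cong (c *_) (^-distribʳ-* d (2 + B) (n + m)) ⟩
      c * ((2 + B) ^ d * (n + m) ^ d)     ≡⟨ *-assoc c _ _ ⟨
      c * (2 + B) ^ d * (n + m) ^ d       ∎
      where
      N : ℕ
      N = fuel B n m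
      instance
        N≢0 : NonZero N
        N≢0 = >-nonZero (≤-trans (>-nonZero⁻¹ m) (m≤m+n m (n * 2 + B)))
    run : Bounded (c * (2 + B) ^ d) d
    run n m r with halts n m r
    ... | t , q , t≤ = t , (_ , q , refl) , ≤-trans t≤ (total n m)

-- Lists, numbers and search

list : List Tree → Tree
list = foldr _∙_ nil

num : ∀ {k} → Fin k → Tree
num = encodeℕ ∘ toℕ

tab : ∀ {k} → (Fin k → Tree) → Tree
tab f = list (tabulate f)

encodeList-list : {A : Set} (f : A → Tree) (xs : List A) → encodeList f xs ≡ list (map f xs)
encodeList-list f []       = refl
encodeList-list f (x ∷ xs) = cong (f x ∙_) (encodeList-list f xs)

encodePerm-tab : ∀ {n} (π : Perm n) → encodePerm π ≡ tab (λ i → num (π ⟨$⟩ʳ i))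
encodePerm-tab π =
  trans (encodeList-list (λ i → num (π ⟨$⟩ʳ i)) (tabulate id))
        (cong list (map-tabulate id (λ i → num (π ⟨$⟩ʳ i))))

encodeℕ-list : ∀ j → encodeℕ j ≡ list (replicate j nil)
encodeℕ-list zero    = refl
encodeℕ-list (suc j) = cong (nil ∙_) (encodeℕ-list j)

v0 v1 v2 v3 v4 v5 v6 v7 v8 : Tm
v0 = fst
v1 = fst ⊙ snd
v2 = fst ⊙ snd ⊙ snd
v3 = fst ⊙ snd ⊙ snd ⊙ snd
v4 = fst ⊙ snd ⊙ snd ⊙ snd ⊙ snd
v5 = fst ⊙ snd ⊙ snd ⊙ snd ⊙ snd ⊙ snd
v6 = fst ⊙ snd ⊙ snd ⊙ snd ⊙ snd ⊙ snd ⊙ snd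
v7 = fst ⊙ snd ⊙ snd ⊙ snd ⊙ snd ⊙ snd ⊙ snd ⊙ snd
v8 = fst ⊙ snd ⊙ snd ⊙ snd ⊙ snd ⊙ snd ⊙ snd ⊙ snd ⊙ snd

-- Terms are evaluated in an environment v0 ∙ v1 ∙ …; the body of a fold sees
-- element ∙ accumulator ∙ environment, that of first, every and collect sees
-- element ∙ environment.
fold : Tm → Tm → Tm → Tm
fold ℓ init step =
  fst ⊙
  -- Once the list is exhausted the state no longer changes, so N rounds serve every list of length
  -- at most N.
  iter (cond v1 (step ⊙ (fst ⊙ v1 & v0 & snd ⊙ snd) & snd ⊙ v1 & snd ⊙ snd) this) ⊙
  (init & ℓ & this)

no′ : Tm → Tm
no′ e = cond e (const nil) (const (nil ∙ nil))

both : Tm → Tm → Tm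
both e f = cond e f (const nil)

first : Tm → Tm → Tm
first ℓ body = fold ℓ (const nil) (cond v1 v1 (body ⊙ (v0 & snd ⊙ snd)))

every : Tm → Tm → Tm
every ℓ body = no′ (first ℓ (no′ body))

-- The inner fold yields the results in reverse order; the outer one reverses them back.
collect : Tm → Tm → Tm
collect ℓ body =
  fold (fold ℓ (const nil) (body ⊙ (v0 & snd ⊙ snd) & v1)) (const nil) (v0 & v1)

nth : Tm → Tm → Tm
nth e i = fst ⊙ fold i e (snd ⊙ v1)

minus : Tm → Tm → Tm
minus e f = fold f e (snd ⊙ v1)

equal : Tm → Tm → Tm
equal e f = both (no′ (minus e f)) (no′ (minus f e))

-- Each round adds one to all entries (a further nil in front of each) and then puts the numeral 0,
-- which is nil, at the head.
range : Tm → Tm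
range e = fold e (const nil) (const nil & collect v1 (const nil & v0))

-- A describes the payload of an answer, B is what the absence of an answer refutes.
data Outcome (A : Tree → Set) (B : Set) : Tree → Set where
  found : ∀ {u v} → A v → Outcome A B (u ∙ v)
  none  : ¬ B → Outcome A B nil

map-outcome : ∀ {A A′ : Tree → Set} {B B′ : Set} {t} →
  (∀ {v} → A v → A′ v) → (B′ → B) → Outcome A B t → Outcome A′ B′ t
map-outcome f g (found a) = found (f a)
map-outcome f g (none ¬b) = none (¬b ∘ g)

-- Correctness of the derived operations

module Eval (N : ℕ) where

  record Value (e : Tm) (x t : Tree) : Set where
    constructor val
    field value : eval N e x ≡ t
  open Value public

  record Result (e : Tm) (x : Tree) (A : Tree → Set) (B : Set) : Set where
    constructor res
    field outcome : Outcome A B (eval N e x)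
  open Result public

  Decides : Tm → Tree → Set → Set
  Decides e x P = Result e x (λ _ → P) P

  map-result : ∀ {e x} {A A′ : Tree → Set} {B B′ : Set} →
    (∀ {v} → A v → A′ v) → (B′ → B) → Result e x A B → Result e x A′ B′
  map-result f g (res o) = res (map-outcome f g o)

  map-decides : ∀ {e x} {P Q : Set} → (P → Q) → (Q → P) → Decides e x P → Decides e x Q
  map-decides f g = map-result f g

  -- The evaluated term is itself a decision procedure for P, so double negations can be removed
  -- without a separate proof of decidability.
  decides-stable : ∀ {e x P} → Decides e x P → ¬ ¬ P → P
  decides-stable {e} {x} (res o) ¬¬p with eval N e x | o
  ... | _ | found p = p
  ... | _ | none ¬p = ⊥-elim (¬¬p ¬p)

  infixl 5 _⟶_

  _⟶_ : ∀ {e x s t} → Value e x s → s ≡ t → Value e x t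
  val p ⟶ q = val (trans p q)

  perm-value : ∀ {j e x} (π : Perm j) → Value e x (encodePerm π) → Value e x (tab λ i → num (π ⟨$⟩ʳ i))
  perm-value π p = p ⟶ encodePerm-tab π

  ⊙-value : ∀ {e f x y t} → Value f x y → Value e y t → Value (e ⊙ f) x t
  ⊙-value {e} (val p) (val q) = val (trans (cong (eval N e) p) q)

  ⊙-result : ∀ {e f x y A B} → Value f x y → Result e y A B → Result (e ⊙ f) x A B
  ⊙-result {e} (val p) (res o) = res (subst (Outcome _ _ ∘ eval N e) (sym p) o)

  &-value : ∀ {e f x s t} → Value e x s → Value f x t → Value (e & f) x (s ∙ t)
  &-value (val p) (val q) = val (cong₂ _∙_ p q)

  fold-value : ∀ {ℓ init step x} ys → Value ℓ x (list ys) → length ys ≤ N →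
    Value (fold ℓ init step) x (foldl (λ acc y → eval N step (y ∙ acc ∙ x)) (eval N init x) ys)
  fold-value {ℓ} {init} {step} {x} ys (val p) ys≤N = val (trans
    (cong (λ z → head (iterate f N (eval N init x ∙ z ∙ x))) p)
    (loop N ys (eval N init x) ys≤N))
    where
    f : Tree → Tree
    f = eval N (cond v1 (step ⊙ (fst ⊙ v1 & v0 & snd ⊙ snd) & snd ⊙ v1 & snd ⊙ snd) this)
    loop : ∀ j ys acc → length ys ≤ j → head (iterate f j (acc ∙ list ys ∙ x)) ≡
      foldl (λ acc y → eval N step (y ∙ acc ∙ x)) acc ys
    loop zero    []       acc _       = refl
    loop (suc j) []       acc _       = loop j [] acc z≤n
    loop (suc j) (y ∷ ys) acc (s≤s q) = loop j ys _ q

  no-decides : ∀ {P e x} → Decides e x P → Decides (no′ e) x (¬ P)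
  no-decides {P} {e} {x} (res d) = res (go (eval N e x) d)
    where
    go : ∀ t → Outcome (λ _ → P) P t → Outcome (λ _ → ¬ P) (¬ P) (choose t nil (nil ∙ nil))
    go _ (found p) = none (λ ¬p → ¬p p)
    go _ (none ¬p) = found ¬p

  cond-result : ∀ {P e f g x A B} → Decides e x P →
    (P → Result f x A B) → (¬ P → Result g x A B) → Result (cond e f g) x A B
  cond-result {P} {e} {f} {g} {x} {A} {B} (res d) h k = res (go (eval N e x) d)
    where
    go : ∀ t → Outcome (λ _ → P) P t → Outcome A B (choose t (eval N f x) (eval N g x))
    go _ (found p) = outcome (h p)
    go _ (none ¬p) = outcome (k ¬p)

  nil-result : ∀ {x A B} → ¬ B → Result (const nil) x A B
  nil-result ¬b = res (none ¬b)

  both-decides : ∀ {P Q e f x} → Decides e x P → Decides f x Q → Decides (both e f) x (P × Q)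
  both-decides d d′ =
    cond-result d (λ p → map-decides (p ,_) proj₂ d′) (λ ¬p → nil-result (¬p ∘ proj₁))

  first-result : ∀ {T : Set} {A : T → Tree → Set} {B : T → Set} (enc : T → Tree) {ℓ body x} ts →
    Value ℓ x (list (map enc ts)) → length ts ≤ N →
    (∀ t → Result body (enc t ∙ x) (A t) (B t)) →
    Result (first ℓ body) x (λ v → Any (λ t → A t v) ts) (Any B ts)
  first-result {T} {A} {B} enc {ℓ} {body} {x} ts p ts≤N h =
    res (subst (Outcome _ _) (sym (value folded)) (go ts))
    where
    step : Tm
    step = cond v1 v1 (body ⊙ (v0 & snd ⊙ snd))
    f : Tree → Tree → Tree
    f acc y = eval N step (y ∙ acc ∙ x)
    folded : Value (first ℓ body) x (foldl f nil (map enc ts))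
    folded = fold-value {init = const nil} {step} (map enc ts) p
      (subst (_≤ N) (sym (length-map enc ts)) ts≤N)
    stay : ∀ {u v} ys → foldl f (u ∙ v) ys ≡ u ∙ v
    stay []       = refl
    stay (y ∷ ys) = stay ys
    go : ∀ ts → Outcome (λ v → Any (λ t → A t v) ts) (Any B ts) (foldl f nil (map enc ts))
    go []       = none λ ()
    go (t ∷ ts) with eval N body (enc t ∙ x) | outcome (h t)
    ... | _ | found {u} {v} a = subst (Outcome _ _) (sym (stay (map enc ts))) (found (here a))
    ... | _ | none ¬b = map-outcome there (λ { (here b) → ⊥-elim (¬b b) ; (there q) → q }) (go ts)

  first-result-Fin : ∀ {k} {A : Fin k → Tree → Set} {B : Fin k → Set} {enc : Fin k → Tree} {ℓ body x} →
    Value ℓ x (tab enc) → k ≤ N →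
    (∀ i → Result body (enc i ∙ x) (A i) (B i)) →
    Result (first ℓ body) x (λ v → ∃[ i ] A i v) (∃[ i ] B i)
  first-result-Fin {k} {enc = enc} p k≤N h =
    map-result (tabulate⁻ {f = id}) (λ (i , b) → tabulate⁺ {f = id} i b)
      (first-result enc (tabulate id) (p ⟶ cong list (sym (map-tabulate id enc)))
        (subst (_≤ N) (sym (length-tabulate id)) k≤N) h)

  -- A universal statement is tested as a failed search for a counterexample; stability of the
  -- single instances removes the double negation.
  every-decides : ∀ {T : Set} {P : T → Set} (enc : T → Tree) {ℓ body x} ts →
    Value ℓ x (list (map enc ts)) → length ts ≤ N →
    (∀ t → Decides body (enc t ∙ x) (P t)) →
    Decides (every ℓ body) x (All P ts)
  every-decides enc ts p ts≤N h = map-decides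
    (λ ¬∃ → All.tabulate λ {t} t∈ → decides-stable (h t) λ ¬p → ¬∃ (lose t∈ ¬p))
    All⇒¬Any¬
    (no-decides (first-result enc ts p ts≤N (λ t → no-decides (h t))))
    where
    All⇒¬Any¬ : ∀ {T : Set} {P : T → Set} {ts : List T} → All P ts → ¬ Any (¬_ ∘ P) ts
    All⇒¬Any¬ (p ∷ _)  (here ¬p)  = ¬p p
    All⇒¬Any¬ (_ ∷ ps) (there ¬p) = All⇒¬Any¬ ps ¬p

  every-decides-Fin : ∀ {k} {P : Fin k → Set} {enc : Fin k → Tree} {ℓ body x} →
    Value ℓ x (tab enc) → k ≤ N →
    (∀ i → Decides body (enc i ∙ x) (P i)) →
    Decides (every ℓ body) x (∀ i → P i)
  every-decides-Fin p k≤N h = map-decides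
    (λ ¬∃ i → decides-stable (h i) (λ ¬p → ¬∃ (i , ¬p))) (λ ∀p (i , ¬p) → ¬p (∀p i))
    (no-decides (first-result-Fin p k≤N (λ t → no-decides (h t))))

  collect-value : ∀ {T : Set} (enc : T → Tree) {g : T → Tree} {ℓ body x} ts →
    Value ℓ x (list (map enc ts)) → length ts ≤ N →
    (∀ {t} → t ∈ ts → Value body (enc t ∙ x) (g t)) →
    Value (collect ℓ body) x (list (map g ts))
  collect-value {T} enc {g} {ℓ} {body} {x} ts p ts≤N h =
    fold-value {init = const nil} {v0 & v1} (reverse (map g ts)) inner ≤N ⟶ (begin
    foldl (λ acc y → y ∙ acc) nil (reverse (map g ts)) ≡⟨ rev (reverse (map g ts)) [] ⟩
    list (reverse (reverse (map g ts))) ≡⟨ cong list (reverse-involutive (map g ts)) ⟩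
    list (map g ts) ∎)
    where
    open ≡-Reasoning
    step : Tm
    step = body ⊙ (v0 & snd ⊙ snd) & v1
    rev : ∀ ys zs → foldl (λ acc y → y ∙ acc) (list zs) ys ≡ list (ys ʳ++ zs)
    rev []       zs = refl
    rev (y ∷ ys) zs = rev ys (y ∷ zs)
    go : ∀ ts acc → (∀ {t} → t ∈ ts → Value body (enc t ∙ x) (g t)) →
      foldl (λ acc y → eval N body (y ∙ x) ∙ acc) acc (map enc ts)
      ≡ foldl (λ acc y → y ∙ acc) acc (map g ts)
    go []       acc h = refl
    go (t ∷ ts) acc h = trans (go ts _ (h ∘ there))
      (cong (λ z → foldl (λ acc y → y ∙ acc) (z ∙ acc) (map g ts)) (value (h (here refl))))
    inner : Value (fold ℓ (const nil) step) x (list (reverse (map g ts)))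
    inner = fold-value {init = const nil} {step} (map enc ts) p
              (subst (_≤ N) (sym (length-map enc ts)) ts≤N)
            ⟶ trans (go ts nil h) (rev (map g ts) [])
    ≤N : length (reverse (map g ts)) ≤ N
    ≤N = subst (_≤ N) (sym (trans (length-reverse (map g ts)) (length-map g ts))) ts≤N

  collect-value-Fin : ∀ {k} {enc g : Fin k → Tree} {ℓ body x} →
    Value ℓ x (tab enc) → k ≤ N →
    (∀ t → Value body (enc t ∙ x) (g t)) →
    Value (collect ℓ body) x (tab g)
  collect-value-Fin {enc = enc} {g} p k≤N h =
    collect-value enc (tabulate id) (p ⟶ cong list (sym (map-tabulate id enc)))
        (subst (_≤ N) (sym (length-tabulate id)) k≤N) (λ {t} _ → h t)
    ⟶ cong list (map-tabulate id g)

  fold-num : ∀ {e i step x y} (g : Tree → Tree) j → Value i x (encodeℕ j) → Value e x y → j ≤ N →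
    (∀ acc → Value step (nil ∙ acc ∙ x) (g acc)) →
    Value (fold i e step) x (iterate g j y)
  fold-num {e} {i} {step} {x} g j p (val refl) j≤N h =
    fold-value (replicate j nil) (p ⟶ encodeℕ-list j) (subst (_≤ N) (sym (length-replicate j)) j≤N)
    ⟶ go j (eval N e x)
    where
    go : ∀ j acc → foldl (λ acc y → eval N step (y ∙ acc ∙ x)) acc (replicate j nil) ≡ iterate g j acc
    go zero    acc = refl
    go (suc j) acc = trans (go j _) (cong (iterate g j) (value (h acc)))

  nth-value : ∀ {k} {f : Fin k → Tree} {e i x} (a : Fin k) →
    Value e x (tab f) → Value i x (num a) → k ≤ N → Value (nth e i) x (f a)
  nth-value {f = f} a p q k≤N =
    ⊙-value (fold-num tail (toℕ a) q p (≤-trans (<⇒≤ (toℕ<n a)) k≤N) (λ _ → val refl)) (val refl)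
    ⟶ go f a
    where
    go : ∀ {k} (f : Fin k → Tree) a → head (iterate tail (toℕ a) (tab f)) ≡ f a
    go f zero    = refl
    go f (suc a) = go (f ∘ suc) a

  minus-value : ∀ {e f x} a b → Value e x (encodeℕ a) → Value f x (encodeℕ b) → b ≤ N →
    Value (minus e f) x (encodeℕ (a ∸ b))
  minus-value a b p q b≤N = fold-num tail b q p b≤N (λ _ → val refl) ⟶ go a b
    where
    go : ∀ a b → iterate tail b (encodeℕ a) ≡ encodeℕ (a ∸ b)
    go a       zero    = refl
    go zero    (suc b) = trans (go zero b) (cong encodeℕ (0∸n≡0 b))
    go (suc a) (suc b) = go a b

  equal-decides : ∀ {k} {e f x} (a b : Fin k) → Value e x (num a) → Value f x (num b) → k ≤ N →
    Decides (equal e f) x (a ≡ b)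
  equal-decides {k} {e} {f} {x} a b p q k≤N = map-decides
    (λ (u , v) → toℕ-injective (≤-antisym (m∸n≡0⇒m≤n u) (m∸n≡0⇒m≤n v)))
    (λ { refl → n∸n≡0 (toℕ a) , n∸n≡0 (toℕ a) })
    (both-decides
      (zero? (toℕ a ∸ toℕ b) (minus-value (toℕ a) (toℕ b) p q (≤N b)))
      (zero? (toℕ b ∸ toℕ a) (minus-value (toℕ b) (toℕ a) q p (≤N a))))
    where
    ≤N : (a : Fin k) → toℕ a ≤ N
    ≤N a = ≤-trans (<⇒≤ (toℕ<n a)) k≤N
    zero? : ∀ {e} j → Value e x (encodeℕ j) → Decides (no′ e) x (j ≡ 0)
    zero? {e} j (val r) = res (subst (λ t → Outcome _ _ (choose t nil (nil ∙ nil))) (sym r) (go j))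
      where
      go : ∀ j → Outcome (λ _ → j ≡ 0) (j ≡ 0) (choose (encodeℕ j) nil (nil ∙ nil))
      go zero    = found refl
      go (suc j) = none λ ()

  range-value : ∀ {e x} k → Value e x (encodeℕ k) → k ≤ N → Value (range e) x (tab {k} num)
  range-value {e} {x} k p k≤N =
    fold-value {init = const nil} {const nil & collect v1 (const nil & v0)}
      (replicate k nil) (p ⟶ encodeℕ-list k)
      (subst (_≤ N) (sym (length-replicate k)) k≤N)
    ⟶ (trans (go k 0 (subst (_≤ N) (sym (+-identityʳ k)) k≤N)) (cong (λ z → tab {z} num) (+-identityʳ k)))
    where
    go : ∀ j i → j + i ≤ N →
      foldl (λ acc y → nil ∙ eval N (collect v1 (const nil & v0)) (y ∙ acc ∙ x))
            (tab {i} num) (replicate j nil)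
        ≡ tab {j + i} num
    go zero    i _ = refl
    go (suc j) i q = trans
      (cong (λ z → foldl _ (nil ∙ z) (replicate j nil))
        (value (collect-value-Fin {enc = num} {g = num ∘ suc} {ℓ = v1} {body = const nil & v0} (val refl)
          (m+n≤o⇒n≤o (suc j) q) (λ _ → val refl))))
      (trans (go j (suc i) (subst (_≤ N) (sym (+-suc j i)) q)) (cong (λ z → tab {z} num) (+-suc j i)))

-- The exchange permutation

module Exchange {k m : ℕ} where

  Block : Set
  Block = Fin k → Fin m

  SameKernel : ∀ {j} → (Fin k → Fin j) → Block → Set
  SameKernel c e = ∀ a b → (e a ≡ e b → c a ≡ c b) × (c a ≡ c b → e a ≡ e b)

  hit? : (e : Block) (q : Fin m) → Dec (∃[ a ] e a ≡ q)
  hit? e q = any? λ a → e a ≟ᶠ q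

  transfer : Block → Block → Fin m → Fin m
  transfer e f q with hit? e q
  ... | yes (a , _) = f a
  ... | no _        = q

  -- Extends e a ↦ f a to a permutation of Fin m: a point of im f outside im e is
  -- sent backwards along f a ↦ e a until it leaves im f.
  exchange : Block → Block → Fin m → Fin m
  exchange e f q with hit? e q
  ... | yes (a , _) = f a
  ... | no _        = iterate (transfer f e) m q

  module _ {e f : Block} where

    transfer-miss : ∀ {q} → ¬ (∃[ a ] e a ≡ q) → transfer e f q ≡ q
    transfer-miss {q} ¬h with hit? e q
    ... | yes h = contradiction h ¬h
    ... | no _  = refl

    iterate-miss : ∀ j {q} → ¬ (∃[ a ] e a ≡ q) → iterate (transfer e f) j q ≡ q
    iterate-miss zero    ¬h = refl
    iterate-miss (suc j) ¬h = trans (cong (iterate (transfer e f) j) (transfer-miss ¬h)) (iterate-miss j ¬h)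

    exchange-miss : ∀ {q} → ¬ (∃[ a ] e a ≡ q) → exchange e f q ≡ iterate (transfer f e) m q
    exchange-miss {q} ¬h with hit? e q
    ... | yes h = contradiction h ¬h
    ... | no _  = refl

    module _ (same : SameKernel f e) where

      transfer-hit : ∀ a → transfer e f (e a) ≡ f a
      transfer-hit a with hit? e (e a)
      ... | yes (b , p) = proj₁ (same b a) p
      ... | no ¬h       = contradiction (a , refl) ¬h

      exchange-hit : ∀ a → exchange e f (e a) ≡ f a
      exchange-hit a with hit? e (e a)
      ... | yes (b , p) = proj₁ (same b a) p
      ... | no ¬h       = contradiction (a , refl) ¬h

  sym-kernel : ∀ {e f : Block} → SameKernel f e → SameKernel e f
  sym-kernel same a b = proj₂ (same a b) , proj₁ (same a b)

  module _ {e f : Block} (same : SameKernel f e) where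

    private
      g : Fin m → Fin m
      g = transfer f e

    -- Two of the m + 1 iterates of q coincide. Were the last one in im f, all earlier ones would be
    -- too, since `g` fixes every point outside im f. As `g` is injective on im f, the coincidence
    -- cancels down to q = `g` (f a) = e a, which is excluded.
    iterate-leaves : ∀ q → ¬ (∃[ a ] e a ≡ q) → ¬ (∃[ a ] f a ≡ iterate g m q)
    iterate-leaves q ¬e end with pigeonhole (≤-refl {suc m}) (λ i → iterate g (toℕ i) q)
    ... | i , j , i<j , eq = descend (toℕ i) (toℕ j) (toℕ≤pred[n] j) i<j eq
      where
      inside : ∀ i j q → i ≤ j → (∃[ a ] f a ≡ iterate g j q) → ∃[ a ] f a ≡ iterate g i q
      inside zero j q _ h with hit? f q
      ... | yes h′ = h′
      ... | no ¬h  = subst (λ z → ∃[ a ] f a ≡ z) (iterate-miss j ¬h) h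
      inside (suc i) (suc j) q (s≤s i≤j) h = inside i j (g q) i≤j h
      descend : ∀ i j → j ≤ m → i < j → ¬ (iterate g i q ≡ iterate g j q)
      descend zero (suc j) j<m _ eq with inside j m q (<⇒≤ j<m) end
      ... | a , p = ¬e (a , sym (trans eq (trans (iterate-suc g j q)
                      (trans (cong g (sym p)) (transfer-hit (sym-kernel same) a)))))
      descend (suc i) (suc j) j<m (s≤s i<j) eq
        with inside i m q (≤-trans (<⇒≤ i<j) (<⇒≤ j<m)) end | inside j m q (<⇒≤ j<m) end
      ... | a , p | b , r = descend i j (<⇒≤ j<m) i<j
        (trans (sym p) (trans (proj₁ (same a b) ea≡eb) r))
        where
        ea≡eb : e a ≡ e b
        ea≡eb = begin
          e a                 ≡⟨ transfer-hit (sym-kernel same) a ⟨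
          g (f a)             ≡⟨ cong g p ⟩
          g (iterate g i q)   ≡⟨ iterate-suc g i q ⟨
          iterate g (suc i) q ≡⟨ eq ⟩
          iterate g (suc j) q ≡⟨ iterate-suc g j q ⟩
          g (iterate g j q)   ≡⟨ cong g r ⟨
          g (f b)             ≡⟨ transfer-hit (sym-kernel same) b ⟩
          e b                 ∎
          where open ≡-Reasoning

    iterate-back : ∀ q → ¬ (∃[ a ] e a ≡ q) → ∀ j → iterate (transfer e f) j (iterate g j q) ≡ q
    iterate-back q ¬e zero    = refl
    iterate-back q ¬e (suc j) with hit? f (iterate g j q)
    ... | yes (a , p) = trans (cong (iterate (transfer e f) j) (begin
      transfer e f (iterate g (suc j) q) ≡⟨ cong (transfer e f) (iterate-suc g j q) ⟩
      transfer e f (g (iterate g j q))   ≡⟨ cong (transfer e f ∘ g) p ⟨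
      transfer e f (g (f a))             ≡⟨ cong (transfer e f) (transfer-hit (sym-kernel same) a) ⟩
      transfer e f (e a)                 ≡⟨ transfer-hit same a ⟩
      f a                                ≡⟨ p ⟩
      iterate g j q                      ∎)) (iterate-back q ¬e j)
      where open ≡-Reasoning
    -- The forward chain has already stopped; the surplus backward step lands on q itself, which is
    -- fixed because it is not in im e.
    ... | no ¬h = begin
      iterate (transfer e f) (suc j) (iterate g (suc j) q)
        ≡⟨ cong (iterate (transfer e f) (suc j)) (trans (iterate-suc g j q) (transfer-miss ¬h)) ⟩
      iterate (transfer e f) (suc j) (iterate g j q) ≡⟨ iterate-suc _ j _ ⟩
      transfer e f (iterate (transfer e f) j (iterate g j q)) ≡⟨ cong (transfer e f) (iterate-back q ¬e j) ⟩
      transfer e f q ≡⟨ transfer-miss ¬e ⟩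
      q ∎
      where open ≡-Reasoning

  exchange-inverse : ∀ {e f : Block} → SameKernel f e → ∀ q → exchange f e (exchange e f q) ≡ q
  exchange-inverse {e} {f} same q with hit? e q
  ... | yes (a , p) = trans (exchange-hit (sym-kernel same) a) p
  ... | no ¬e       = trans (exchange-miss (iterate-leaves same q ¬e)) (iterate-back same q ¬e m)

  -- Keeps the complement of im e stable under y, so that both branches of `exchange` commute with
  -- y. For a prescribed permutation it follows by multiplying with the inverse of the group
  -- element.
  Invariant : (Fin m → Fin m) → Block → Set
  Invariant y e = ∀ q → (∃[ a ] e a ≡ y q) → ∃[ a ] e a ≡ q

  module _ (y : Fin m → Fin m) (r : Fin k → Fin k) where

    transfer-commutes : ∀ {e f} → SameKernel f e → (∀ a → y (e a) ≡ e (r a)) → (∀ a → y (f a) ≡ f (r a)) →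
      Invariant y e → ∀ q → transfer e f (y q) ≡ y (transfer e f q)
    transfer-commutes {e} {f} same ye yf ie q with hit? e q
    ... | yes (a , refl) = trans (cong (transfer e f) (ye a)) (trans (transfer-hit same (r a)) (sym (yf a)))
    ... | no ¬h          = transfer-miss (¬h ∘ ie q)

    exchange-commutes : ∀ {e f} → SameKernel f e → (∀ a → y (e a) ≡ e (r a)) → (∀ a → y (f a) ≡ f (r a)) →
      Invariant y e → Invariant y f → ∀ q → exchange e f (y q) ≡ y (exchange e f q)
    exchange-commutes {e} {f} same ye yf ie jf q with hit? e q
    ... | yes (a , refl) = trans (cong (exchange e f) (ye a)) (trans (exchange-hit same (r a)) (sym (yf a)))
    ... | no ¬h          = trans (exchange-miss (¬h ∘ ie q)) (go m q)
      where
      go : ∀ j q → iterate (transfer f e) j (y q) ≡ y (iterate (transfer f e) j q)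
      go zero    q = refl
      go (suc j) q = trans (cong (iterate (transfer f e) j)
        (transfer-commutes (sym-kernel same) yf ye jf q)) (go j _)

  -- Blocks placed earlier are disjoint from both images, hence survive the conjugation pointwise.
  exchange-fixes : ∀ {e f : Block} {q} → ¬ (∃[ a ] e a ≡ q) → ¬ (∃[ a ] f a ≡ q) → exchange e f q ≡ q
  exchange-fixes ¬e ¬f = trans (exchange-miss ¬e) (iterate-miss m ¬f)

-- Actions as disjoint unions of blocks

module Actions {k m : ℕ} {_·_ : Fin k → Fin k → Fin k} {ε : Fin k} {_⁻¹ : Fin k → Fin k}
  (isGroup : IsGroup _≡_ _·_ ε _⁻¹) (Γ : List (Fin k × Perm m)) where

  open IsGroup isGroup using (assoc; identityʳ; inverse)
  open Exchange {k} {m} public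

  -- A right action, because `∘ₚ` applies its left factor first.
  record Action : Set where
    field
      act   : Fin m → Fin k → Fin m
      act-ε : ∀ p → act p ε ≡ p
      act-· : ∀ p a b → act (act p a) b ≡ act p (a · b)
      act-Γ : All (λ (x , y) → ∀ p → act p x ≡ y ⟨$⟩ʳ p) Γ
  open Action public

  Kernel : (Fin k → Fin k) → Block → Set
  Kernel = SameKernel

  Moves : List Block → Fin m → Fin k → Fin m → Set
  Moves s p x q = Any (λ e → ∃[ a ] e a ≡ p × e (a · x) ≡ q) s

  Used : List Block → Fin m → Set
  Used s p = Any (λ e → ∃[ a ] e a ≡ p) s

  used? : ∀ s p → Dec (Used s p)
  used? s p = Any.any? (λ e → hit? e p) s

  -- `congruent` lets right multiplication descend to the image of e, which thereby becomes a
  -- transitive G-set disjoint from the earlier blocks.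
  record Valid (s : List Block) (e : Block) : Set where
    constructor valid
    field
      fresh       : ∀ a → ¬ Used s (e a)
      equivariant : All (λ (x , y) → ∀ a → e (a · x) ≡ y ⟨$⟩ʳ e a) Γ
      congruent   : ∀ a b d → e a ≡ e b → e (a · d) ≡ e (b · d)
  open Valid public

  data Good : List Block → Set where
    []  : Good []
    _∷_ : ∀ {e s} → Valid s e → Good s → Good (e ∷ s)

  used : ∀ {s e} a → e ∈ s → Used s (e a)
  used a e∈s = lose e∈s (a , refl)

  coherent : ∀ {s} → Good s → ∀ {e f} → e ∈ s → f ∈ s → ∀ a b d → e a ≡ f b → e (a · d) ≡ f (b · d)
  coherent (v ∷ g) (here refl) (here refl) a b d p = congruent v a b d p
  coherent (v ∷ g) (here refl) (there f∈)  a b d p = contradiction (subst (Used _) (sym p) (used b f∈)) (fresh v a)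
  coherent (v ∷ g) (there e∈)  (here refl) a b d p = contradiction (subst (Used _) p (used a e∈)) (fresh v b)
  coherent (v ∷ g) (there e∈)  (there f∈)  a b d p = coherent g e∈ f∈ a b d p

  good-equivariant : ∀ {s} → Good s → ∀ {e} → e ∈ s → All (λ (x , y) → ∀ a → e (a · x) ≡ y ⟨$⟩ʳ e a) Γ
  good-equivariant (v ∷ g) (here refl) = equivariant v
  good-equivariant (v ∷ g) (there e∈)  = good-equivariant g e∈

  -- Disjoint blocks send ε to distinct points. This is what bounds the number of rounds of the
  -- search.
  good-length : ∀ {s} → Good s → length s ≤ m
  good-length {s} g = ≮⇒≥ λ m< →
    let i , j , i<j , eq = pigeonhole m< (λ i → lookup s i ε) in distinct g i j i<j eq
    where
    distinct : ∀ {s} → Good s → (i j : Fin (length s)) → toℕ i < toℕ j → ¬ (lookup s i ε ≡ lookup s j ε)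
    distinct (_∷_ {s = s} v g) zero    (suc j) _         eq =
      fresh v ε (subst (Used s) (sym eq) (used ε (∈-lookup j)))
    distinct (v ∷ g) (suc i) (suc j) (s≤s i<j) eq = distinct g i j i<j eq

  module _ {s : List Block} (good : Good s) (full : ∀ p → Used s p) where

    private
      move : Fin m → Fin k → Fin m
      -- The choice of a block and a preimage is immaterial: `coherent` compares any two of them.
      move p d = let e , _ , a , _ = find (full p) in e (a · d)

      move-block : ∀ {e} → e ∈ s → ∀ a d → move (e a) d ≡ e (a · d)
      move-block e∈ a d = let f , f∈ , b , p = find (full _) in coherent good f∈ e∈ b a d p

      at-block : {P : Fin m → Set} → (∀ {e} → e ∈ s → ∀ a → P (e a)) → ∀ p → P p
      at-block {P} h p = let e , e∈ , a , q = find (full p) in subst P q (h e∈ a)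

    action : Action
    action .act   = move
    action .act-ε = at-block λ {e} e∈ a → trans (move-block e∈ a ε) (cong e (identityʳ a))
    action .act-· = at-block λ {e} e∈ a b c → begin
      move (move (e a) b) c ≡⟨ cong (λ p → move p c) (move-block e∈ a b) ⟩
      move (e (a · b)) c    ≡⟨ move-block e∈ (a · b) c ⟩
      e ((a · b) · c)       ≡⟨ cong e (assoc a b c) ⟩
      e (a · (b · c))       ≡⟨ move-block e∈ a (b · c) ⟨
      move (e a) (b · c)    ∎
      where open ≡-Reasoning
    action .act-Γ = All.tabulate λ {(x , y)} xy∈ → at-block λ e∈ a →
      trans (move-block e∈ a x) (All.lookup (good-equivariant good e∈) xy∈ a)

    moves-action : ∀ {p x q} → Moves s p x q → q ≡ act action p x
    moves-action mv with find mv
    ... | e , e∈ , a , refl , refl = sym (move-block e∈ a _)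

  Realises : (Fin m → Fin k → Fin m) → List Block → Set
  Realises f = All λ e → ∀ a d → f (e a) d ≡ e (a · d)

  record Extends (s : List Block) (cs : List (Fin k → Fin k)) : Set where
    constructor extends
    field
      by     : Action
      blocks : Realises (act by) s
      types  : ∀ p → ¬ Used s p → Any (λ c → Kernel c (act by p)) cs
  open Extends public

  ·-cancelʳ : ∀ a d → (a · (d ⁻¹)) · d ≡ a
  ·-cancelʳ a d = trans (assoc a (d ⁻¹) d) (trans (cong (a ·_) (proj₁ inverse d)) (identityʳ a))

  module _ (α : Action) {s : List Block} (bl : Realises (act α) s) where

    -- Freshness holds because used points are closed under the action: if the orbit of p met s,
    -- acting by an inverse would put p itself into s.
    orbit-valid : ∀ p → ¬ Used s p → Valid s (act α p)
    orbit-valid p ¬u = valid fr eq co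
      where
      fr : ∀ a → ¬ Used s (act α p a)
      fr a u with find u
      ... | e , e∈ , b , q = ¬u (subst (Used s) eq (used (b · (a ⁻¹)) e∈))
        where
        open ≡-Reasoning
        eq : e (b · (a ⁻¹)) ≡ p
        eq = begin
          e (b · (a ⁻¹))              ≡⟨ All.lookup bl e∈ b (a ⁻¹) ⟨
          act α (e b) (a ⁻¹)          ≡⟨ cong (λ z → act α z (a ⁻¹)) q ⟩
          act α (act α p a) (a ⁻¹)    ≡⟨ act-· α p a (a ⁻¹) ⟩
          act α p (a · (a ⁻¹))        ≡⟨ cong (act α p) (proj₂ inverse a) ⟩
          act α p ε                   ≡⟨ act-ε α p ⟩
          p                           ∎
      eq : All (λ (x , y) → ∀ a → act α p (a · x) ≡ y ⟨$⟩ʳ act α p a) Γ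
      eq = All.map (λ {(x , y)} h a → trans (sym (act-· α p a x)) (h (act α p a))) (act-Γ α)
      co : ∀ a b d → act α p a ≡ act α p b → act α p (a · d) ≡ act α p (b · d)
      co a b d q = trans (sym (act-· α p a d)) (trans (cong (λ z → act α z d) q) (act-· α p b d))

    module _ (p : Fin m) (¬u : ¬ Used s p) {f : Block} (v : Valid s f) (same : SameKernel f (act α p)) where

      private
        e : Block
        e = act α p
        σ τ : Fin m → Fin m
        σ = exchange e f
        τ = exchange f e
        τσ : ∀ q → τ (σ q) ≡ q
        τσ = exchange-inverse same
        στ : ∀ q → σ (τ q) ≡ q
        στ = exchange-inverse (sym-kernel same)
        miss : ∀ {q g} → Used s q → Valid s g → ¬ (∃[ a ] g a ≡ q)
        miss u w (a , refl) = fresh w a u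
        σ-fixes : ∀ {q} → Used s q → σ q ≡ q
        σ-fixes u = exchange-fixes (miss u (orbit-valid p ¬u)) (miss u v)
        τ-fixes : ∀ {q} → Used s q → τ q ≡ q
        τ-fixes u = exchange-fixes (miss u v) (miss u (orbit-valid p ¬u))
        invariant : ∀ {g} (y : Perm m) x → (∀ a → g (a · x) ≡ y ⟨$⟩ʳ g a) → Invariant (y ⟨$⟩ʳ_) g
        invariant {g} y x h q (a , r) = a · (x ⁻¹) , (begin
          g (a · (x ⁻¹))                            ≡⟨ inverseˡ y ⟨
          y ⟨$⟩ˡ (y ⟨$⟩ʳ g (a · (x ⁻¹)))            ≡⟨ cong (y ⟨$⟩ˡ_) (h (a · (x ⁻¹))) ⟨
          y ⟨$⟩ˡ g ((a · (x ⁻¹)) · x)               ≡⟨ cong (λ z → y ⟨$⟩ˡ g z) (·-cancelʳ a x) ⟩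
          y ⟨$⟩ˡ g a                                ≡⟨ cong (y ⟨$⟩ˡ_) r ⟩
          y ⟨$⟩ˡ (y ⟨$⟩ʳ q)                         ≡⟨ inverseˡ y ⟩
          q                                         ∎)
          where open ≡-Reasoning

      conjugate : Action
      conjugate .act q d = σ (act α (τ q) d)
      conjugate .act-ε q = trans (cong σ (act-ε α (τ q))) (στ q)
      conjugate .act-· q a b = cong σ (trans (cong (λ z → act α z b) (τσ _)) (act-· α (τ q) a b))
      conjugate .act-Γ = All.tabulate λ {(x , y)} xy∈ q → begin
        σ (act α (τ q) x)   ≡⟨ cong σ (All.lookup (act-Γ α) xy∈ (τ q)) ⟩
        σ (y ⟨$⟩ʳ τ q)      ≡⟨ exchange-commutes (y ⟨$⟩ʳ_) (_· x) same
                                 (λ a → sym (All.lookup (equivariant (orbit-valid p ¬u)) xy∈ a))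
                                 (λ a → sym (All.lookup (equivariant v) xy∈ a))
                                 (invariant y x (All.lookup (equivariant (orbit-valid p ¬u)) xy∈))
                                 (invariant y x (All.lookup (equivariant v) xy∈)) (τ q) ⟩
        y ⟨$⟩ʳ σ (τ q)      ≡⟨ cong (y ⟨$⟩ʳ_) (στ q) ⟩
        y ⟨$⟩ʳ q            ∎
        where open ≡-Reasoning

      exchange-extends : ∀ {cs} → (∀ q → ¬ Used s q → Any (λ c → Kernel c (act α q)) cs) → Extends (f ∷ s) cs
      exchange-extends ty = extends conjugate (new ∷ All.tabulate old) λ q ¬q →
        Any.map (λ {c} ker a b → proj₁ (ker a b) ∘ σ-injective , cong σ ∘ proj₂ (ker a b))
          (ty (τ q) λ u → ¬q (there (subst (Used s) (trans (sym (σ-fixes u)) (στ q)) u)))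
        where
        open ≡-Reasoning
        σ-injective : ∀ {q r} → σ q ≡ σ r → q ≡ r
        σ-injective {q} {r} z = trans (sym (τσ q)) (trans (cong τ z) (τσ r))
        new : ∀ a d → σ (act α (τ (f a)) d) ≡ f (a · d)
        new a d = begin
          σ (act α (τ (f a)) d) ≡⟨ cong (λ z → σ (act α z d)) (exchange-hit (sym-kernel same) a) ⟩
          σ (act α (e a) d)     ≡⟨ cong σ (act-· α p a d) ⟩
          σ (e (a · d))         ≡⟨ exchange-hit same (a · d) ⟩
          f (a · d)             ∎
        old : ∀ {g} → g ∈ s → ∀ a d → σ (act α (τ (g a)) d) ≡ g (a · d)
        old {g} g∈ a d = begin
          σ (act α (τ (g a)) d) ≡⟨ cong (λ z → σ (act α z d)) (τ-fixes (used a g∈)) ⟩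
          σ (act α (g a) d)     ≡⟨ cong σ (All.lookup bl g∈ a d) ⟩
          σ (g (a · d))         ≡⟨ σ-fixes (used (a · d) g∈) ⟩
          g (a · d)             ∎

-- The search for an action

-- Every environment below ends in ρ = indices ∙ points ∙ multiplication table ∙
-- constraints, preceded by s for a list of blocks.  In front of s ∙ ρ, isUsed expects
-- a point, moves a point and an element of the group, and isBlock a block and a type.
isUsed moves isFull : Tm
isUsed = first v1 (first v3 (equal (nth v1 v0) v2))
moves  = first v2 (first v4
  (cond (equal (nth v1 v0) v2) (const nil & nth v1 (nth (nth v7 v3) v0)) (const nil)))
isFull = every v2 isUsed

isFresh hasKernel isEquivariant isCongruent isBlock : Tm
isFresh       = every v3 (no′ (isUsed ⊙ (nth v1 v0 & snd ⊙ snd ⊙ snd)))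
hasKernel     = every v3 (every v4
  (cond (equal (nth v2 v1) (nth v2 v0)) (equal (nth v3 v1) (nth v3 v0)) (no′ (equal (nth v3 v1) (nth v3 v0)))))
isEquivariant = every v6 (every v4
  (equal (nth v2 (nth (nth v7 (fst ⊙ v1)) v0)) (nth (snd ⊙ v1) (nth v2 v0))))
isCongruent   = every v3 (every v4 (every v5
  (cond (equal (nth v3 v2) (nth v3 v1))
        (equal (nth v3 (nth (nth v8 v0) v2)) (nth v3 (nth (nth v8 v0) v1)))
        (const (nil ∙ nil)))))
isBlock       = both (both isFresh hasKernel) (both isEquivariant isCongruent)

-- In the environment es ∙ s ∙ ρ, extends es by j further points in front.
tuples : ℕ → Tree → Tm
tuples zero    c = cond (isBlock ⊙ (v0 & const c & snd)) (const nil & v0 & v1) (const nil)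
tuples (suc j) c = first v3 (tuples j c ⊙ ((v0 & v1) & snd ⊙ snd))

-- The loop state is result ∙ current blocks ∙ ρ, the blocks being wrapped in a pair
-- to tell the empty list from failure.
search : ℕ → List Tree → Tm
search k []       = cond isFull (const nil & v0) (const nil)
search k (c ∷ cs) =
  fst ⊙
  iter (cond v0 this (cond v1
    (search k cs ⊙ (snd ⊙ v1 & snd ⊙ snd) &
     tuples k c ⊙ (const nil & snd ⊙ v1 & snd ⊙ snd) & snd ⊙ snd)
    this)) ⊙
  (const nil & (const nil & v0) & snd)

-- Representatives of the orbit types

block : ∀ {k m} → (Fin k → Fin m) → Tree
block e = tab (num ∘ e)

functions : ∀ k j → List (Fin k → Fin j)
functions zero    j = (λ ()) ∷ []
functions (suc k) j = map (λ { (i , f) zero → i ; (i , f) (suc a) → f a })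
                          (cartesianProduct (allFin j) (functions k j))

functions-complete : ∀ {k j} (f : Fin k → Fin j) → Any (λ g → ∀ a → g a ≡ f a) (functions k j)
functions-complete {zero}  f = here λ ()
functions-complete {suc k} f = Any.map⁺ (Any.map (λ { (p , q) zero → p ; (p , q) (suc a) → q a })
  (cartesianProduct⁺ (tabulate⁺ {f = id} (f zero) refl) (functions-complete (f ∘ suc))))

-- The representative sends a to the index that `hit?` returns for e a. It depends on the value e a
-- only, and e maps it back to that value, so its kernel is that of e.
kernels-complete : ∀ {k m} (e : Fin k → Fin m) → Any (λ c → Exchange.SameKernel c e) (functions k k)
kernels-complete {k} {m} e = Any.map same (functions-complete (λ a → pick (a , refl)))
  where
  open Exchange {k} {m} using (hit?)
  pick : ∀ {q} → ∃[ a ] e a ≡ q → Fin k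
  pick {q} h with hit? e q
  ... | yes (a , _) = a
  -- Default value; h rules this case out.
  ... | no _        = proj₁ h
  pick-hits : ∀ {q} (h : ∃[ a ] e a ≡ q) → e (pick h) ≡ q
  pick-hits {q} h with hit? e q
  ... | yes (_ , p) = p
  ... | no _        = proj₂ h
  pick-unique : ∀ {q} (h h′ : ∃[ a ] e a ≡ q) → pick h ≡ pick h′
  pick-unique {q} h h′ with hit? e q
  ... | yes _ = refl
  ... | no ¬h = contradiction h ¬h
  same : ∀ {c : Fin k → Fin k} → (∀ a → c a ≡ pick (a , refl)) → Exchange.SameKernel c e
  same {c} c≡ a b =
    (λ p → trans (c≡ a) (trans (agree p) (sym (c≡ b)))) ,
    (λ p → trans (sym (pick-hits (a , refl))) (trans (cong e (trans (sym (c≡ a)) (trans p (c≡ b))))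
                                                    (pick-hits (b , refl))))
    where
    agree : e a ≡ e b → pick (a , refl) ≡ pick (b , refl)
    agree p = go p (a , refl) (b , refl)
      where
      go : ∀ {q r} → q ≡ r → (h : ∃[ a ] e a ≡ q) (h′ : ∃[ a ] e a ≡ r) → pick h ≡ pick h′
      go refl = pick-unique

-- Correctness of the search

module Search (N : ℕ) {k m : ℕ} (k≤N : k ≤ N) (m<N : m < N)
  {_·_ : Fin k → Fin k → Fin k} {ε : Fin k} {_⁻¹ : Fin k → Fin k}
  (isGroup : IsGroup _≡_ _·_ ε _⁻¹)
  (Γ : List (Fin k × Perm m)) (Γ≤N : length Γ ≤ N) where

  open Eval N
  open Actions isGroup Γ

  m≤N : m ≤ N
  m≤N = <⇒≤ m<N

  constraint : Fin k × Perm m → Tree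
  constraint (x , y) = num x ∙ encodePerm y

  table : Tree
  table = tab λ d → tab λ a → num (a · d)

  state : List Block → Tree
  state s = list (map block s)

  ρ : Tree
  ρ = tab {k} num ∙ tab {m} num ∙ table ∙ list (map constraint Γ) ∙ nil

  state≤N : ∀ {s} → Good s → length s ≤ N
  state≤N g = ≤-trans (good-length g) m≤N

  times : ∀ {e f g x} a d → Value e x table → Value f x (num d) → Value g x (num a) →
    Value (nth (nth e f) g) x (num (a · d))
  times a d p q r = nth-value a (nth-value {f = λ d → tab λ a → num (a · d)} d p q k≤N) r k≤N

  point : ∀ {f g x} (e : Block) a → Value f x (block e) → Value g x (num a) → Value (nth f g) x (num (e a))
  point e a p q = nth-value a p q k≤N

  isUsed-decides : ∀ {s} → Good s → ∀ p → Decides isUsed (num p ∙ state s ∙ ρ) (Used s p)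
  isUsed-decides {s} g p = first-result block s (val refl) (state≤N g) λ e →
    first-result-Fin {enc = num} (val refl) k≤N λ a →
      equal-decides (e a) p (point e a (val refl) (val refl)) (val refl) m≤N

  moves-result : ∀ {s} → Good s → ∀ p x →
    Result moves (num p ∙ num x ∙ state s ∙ ρ) (λ v → ∃[ q ] v ≡ num q × Moves s p x q) (Used s p)
  moves-result {s} g p x = map-result unpack id
    (first-result block s (val refl) (state≤N g) λ e →
      first-result-Fin {enc = num} (val refl) k≤N λ a →
        cond-result (equal-decides (e a) p (point e a (val refl) (val refl)) (val refl) m≤N)
          (λ ea≡p → res (found (ea≡p ,
             value (point {v1} {nth (nth v7 v3) v0} e (a · x) (val refl)
               (times {v7} {v3} {v0} a x (val refl) (val refl) (val refl))))))
          nil-result)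
    where
    unpack : ∀ {v} → Any (λ e → ∃[ a ] e a ≡ p × v ≡ num (e (a · x))) s → ∃[ q ] v ≡ num q × Moves s p x q
    unpack u = let e , e∈ , a , eq , v≡ = find u in e (a · x) , v≡ , lose e∈ (a , eq , refl)

  isFull-decides : ∀ {s} → Good s → Decides isFull (state s ∙ ρ) (∀ p → Used s p)
  isFull-decides g = every-decides-Fin {enc = num} (val refl) m≤N (isUsed-decides g)

  isBlock-decides : ∀ {s} → Good s → ∀ e c →
    Decides isBlock (block e ∙ block c ∙ state s ∙ ρ) (Valid s e × Kernel c e)
  isBlock-decides {s} g e c = map-decides
    (λ { ((f , ker) , (eq , co)) → valid f eq co , ker })
    (λ { (valid f eq co , ker) → (f , ker) , (eq , co) })
    (both-decides (both-decides
      (every-decides-Fin {enc = num} (val refl) k≤N λ a → no-decides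
        (⊙-result (&-value (point e a (val refl) (val refl)) (val refl)) (isUsed-decides g (e a))))
      (every-decides-Fin {enc = num} (val refl) k≤N λ a →
        every-decides-Fin {enc = num} (val refl) k≤N λ b →
          cond-result (equal-decides (e a) (e b) (point e a (val refl) (val refl))
                        (point e b (val refl) (val refl)) m≤N)
            (λ p → map-decides (λ q → (λ _ → q) , (λ _ → p)) (λ h → proj₁ h p) (same a b))
            (λ ¬p → map-decides (λ ¬q → (λ p → contradiction p ¬p) , (λ q → contradiction q ¬q))
                                 (λ h → ¬p ∘ proj₂ h) (no-decides (same a b)))))
      (both-decides
        (every-decides constraint Γ (val refl) Γ≤N λ (x , y) →
          every-decides-Fin {enc = num} (val refl) k≤N λ a →
            equal-decides (e (a · x)) (y ⟨$⟩ʳ e a)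
              (point e (a · x) (val refl) (times a x (val refl) (val refl) (val refl)))
              (nth-value (e a) (perm-value y (val refl)) (point e a (val refl) (val refl)) m≤N) m≤N)
        (every-decides-Fin {enc = num} (val refl) k≤N λ a →
          every-decides-Fin {enc = num} (val refl) k≤N λ b →
            every-decides-Fin {enc = num} (val refl) k≤N λ d →
              cond-result (equal-decides (e a) (e b) (point e a (val refl) (val refl))
                            (point e b (val refl) (val refl)) m≤N)
                (λ p → map-decides (λ q _ → q) (λ h → h p)
                  (equal-decides (e (a · d)) (e (b · d))
                    (point e (a · d) (val refl) (times a d (val refl) (val refl) (val refl)))
                    (point e (b · d) (val refl) (times b d (val refl) (val refl) (val refl))) m≤N))
                (λ ¬p → res (found λ p → contradiction p ¬p)))))
    where
    same : ∀ a b → Decides (equal (nth v3 v1) (nth v3 v0))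
      (num b ∙ num a ∙ block e ∙ block c ∙ state s ∙ ρ) (c a ≡ c b)
    same a b = equal-decides (c a) (c b)
      (nth-value a (val refl) (val refl) k≤N) (nth-value b (val refl) (val refl) k≤N) k≤N

  tabulate-injective : ∀ {j} {A : Set} {e f : Fin j → A} → tabulate e ≡ tabulate f → ∀ a → e a ≡ f a
  tabulate-injective p zero    = ∷-injectiveˡ p
  tabulate-injective p (suc a) = tabulate-injective (∷-injectiveʳ p) a

  tabulate-surjective : ∀ {A : Set} (es : List A) {j} → length es ≡ j → ∃[ e ] tabulate {n = j} e ≡ es
  tabulate-surjective es refl = lookup es , tabulate-lookup es

  Candidate : List Block → (Fin k → Fin k) → Block → Set
  Candidate s c e = Valid s e × Kernel c e

  candidate-resp : ∀ {s c e f} → (∀ a → e a ≡ f a) → Candidate s c e → Candidate s c f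
  candidate-resp {s} p (valid fr eq co , ker) =
    valid (λ a u → fr a (subst (Used s) (sym (p a)) u))
          (All.map (λ {(x , y)} h a → trans (sym (p (a · x))) (trans (h a) (cong (y ⟨$⟩ʳ_) (p a)))) eq)
          (λ a b d q → trans (sym (p (a · d))) (trans (co a b d (trans (p a) (trans q (sym (p b))))) (p (b · d)))) ,
    λ a b → (λ q → proj₁ (ker a b) (trans (p a) (trans q (sym (p b))))) ,
            (λ q → trans (sym (p a)) (trans (proj₂ (ker a b) q) (p b)))

  Embedding : List Block → (Fin k → Fin k) → Tree → Set
  Embedding s c v = ∃[ e ] v ≡ state (e ∷ s) × Candidate s c e

  -- Points are put in front one at a time, so the further points ps appear in reverse order before
  -- es.
  Completion : List Block → (Fin k → Fin k) → ℕ → List (Fin m) → Set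
  Completion s c j es = ∃[ ps ] length ps ≡ j × ∃[ e ] tabulate e ≡ ps ʳ++ es × Candidate s c e

  tuples-result : ∀ {s} → Good s → ∀ c j es → j + length es ≡ k →
    Result (tuples j (block c)) (list (map num es) ∙ state s ∙ ρ) (Embedding s c) (Completion s c j es)
  tuples-result {s} g c zero es len with tabulate-surjective es len
  ... | e , refl = subst
    (λ t → Result (tuples 0 (block c)) (t ∙ state s ∙ ρ) (Embedding s c) (Completion s c 0 (tabulate e)))
    (cong list (sym (map-tabulate e num)))
    (cond-result (⊙-result (val refl) (isBlock-decides g e c))
      (λ cand → res (found (e , refl , cand)))
      (λ ¬cand → nil-result λ { ([] , _ , f , p , cand) → ¬cand (candidate-resp (tabulate-injective p) cand) }))
  tuples-result {s} g c (suc j) es len = map-result proj₂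
    (λ { (p ∷ ps , refl , rest) → p , ps , refl , rest })
    (first-result-Fin {enc = num} (val refl) m≤N λ p →
      ⊙-result (val refl) (tuples-result g c j (p ∷ es) (trans (+-suc j (length es)) len)))

  embed-result : ∀ {s} → Good s → ∀ c → Result (tuples k (block c)) (nil ∙ state s ∙ ρ)
    (Embedding s c) (∃[ e ] Candidate s c e)
  embed-result g c = map-result id
    (λ (e , cand) → reverse (tabulate e) , trans (length-reverse (tabulate e)) (length-tabulate e) ,
                     e , sym (reverse-involutive (tabulate e)) , cand)
    (tuples-result g c k [] (+-identityʳ k))

  Complete : Tree → Set
  Complete v = ∃[ s ] v ≡ state s × Good s × (∀ p → Used s p)

  module _ {s : List Block} {c : Fin k → Fin k} {cs : List (Fin k → Fin k)} where

    unused-drop : (E : Extends s (c ∷ cs)) → ¬ (∃[ p ] ¬ Used s p × Kernel c (act (by E) p)) → Extends s cs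
    unused-drop (extends α bl ty) ¬p = extends α bl λ p ¬u → drop p ¬u (ty p ¬u)
      where
      drop : ∀ p → ¬ Used s p → Any (λ c → Kernel c (act α p)) (c ∷ cs) → Any (λ c → Kernel c (act α p)) cs
      drop p ¬u (here ker) = contradiction (p , ¬u , ker) ¬p
      drop p ¬u (there q)  = q

    no-embedding : ¬ Extends s cs → ¬ (∃[ e ] Candidate s c e) → ¬ Extends s (c ∷ cs)
    no-embedding ¬E ¬c E@(extends α bl ty) = ¬E (unused-drop E λ (p , ¬u , ker) →
      ¬c (act α p , orbit-valid α bl p ¬u , ker))

    no-extension : ∀ {e} → ¬ Extends s cs → Candidate s c e → ¬ Extends (e ∷ s) (c ∷ cs) → ¬ Extends s (c ∷ cs)
    no-extension {e} ¬E (v , ker) ¬E′ E@(extends α bl ty) = ¬E (unused-drop E λ (p , ¬u , ker′) →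
      ¬E′ (exchange-extends α bl p ¬u v
        (λ a b → (λ q → proj₂ (ker a b) (proj₁ (ker′ a b) q)) , (λ q → proj₂ (ker′ a b) (proj₁ (ker a b) q))) ty))

  -- The rounds of the loop run through the multiplicities of c. Each tries to finish with the later
  -- types only; if that fails, one more block of type c is committed to, at no loss by
  -- `no-extension`, or there is none and `no-embedding` applies.
  search-result : ∀ cs {s} → Good s →
    Result (search k (map block cs)) (state s ∙ ρ) Complete (Extends s cs)
  search-result [] {s} g = cond-result (isFull-decides g)
    (λ full → res (found (s , refl , g , full)))
    (λ ¬full → nil-result λ E → ¬full λ p → decidable-stable (used? s p) λ ¬u → ¬Any[] (types E p ¬u))
  -- Up to m blocks may be added and a last round must still test the result, hence the strict
  -- inequality m < N.
  search-result (c ∷ cs) {s} g = res (loop N s nil g (≤-trans m<N (m≤m+n N (length s))))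
    where
    F : Tree → Tree
    F = eval N (cond v0 this (cond v1
          (search k (map block cs) ⊙ (snd ⊙ v1 & snd ⊙ snd) &
           tuples k (block c) ⊙ (const nil & snd ⊙ v1 & snd ⊙ snd) & snd ⊙ snd)
          this))
    stay-found : ∀ j {u v t} → iterate F j ((u ∙ v) ∙ t) ≡ (u ∙ v) ∙ t
    stay-found zero    = refl
    stay-found (suc j) = stay-found j
    stay-none : ∀ j → iterate F j (nil ∙ nil ∙ ρ) ≡ nil ∙ nil ∙ ρ
    stay-none zero    = refl
    stay-none (suc j) = stay-none j
    loop : ∀ j s u → Good s → m < j + length s →
      Outcome Complete (Extends s (c ∷ cs)) (head (iterate F j (nil ∙ (u ∙ state s) ∙ ρ)))
    loop zero    s u g m< = contradiction m< (≤⇒≯ (good-length g))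
    loop (suc j) s u g m< = go _ _ (outcome (search-result cs g)) (outcome (embed-result g c))
      where
      go : ∀ r t → Outcome Complete (Extends s cs) r → Outcome (Embedding s c) (∃[ e ] Candidate s c e) t →
        Outcome Complete (Extends s (c ∷ cs)) (head (iterate F j (r ∙ t ∙ ρ)))
      go (r ∙ r′) _ (found a) _ = subst (Outcome _ _ ∘ head) (sym (stay-found j)) (found a)
      go _ _ (none ¬E) (none ¬c) = subst (Outcome _ _ ∘ head) (sym (stay-none j)) (none (no-embedding ¬E ¬c))
      go _ (u ∙ _) (none ¬E) (found (e , refl , cand)) =
        next (loop j (e ∷ s) u (proj₁ cand ∷ g) (subst (m <_) (sym (+-suc j (length s))) m<))
        where
        next : ∀ {t} → Outcome Complete (Extends (e ∷ s) (c ∷ cs)) t → Outcome Complete (Extends s (c ∷ cs)) t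
        next (found a)  = found a
        next (none ¬E′) = none (no-extension ¬E cand ¬E′)

-- The group on Fin k

module _ {n : ℕ} where

  _≈?_ : (π ρ : Perm n) → Dec (π ≈ ρ)
  π ≈? ρ = all? λ i → (π ⟨$⟩ʳ i) ≟ᶠ (ρ ⟨$⟩ʳ i)

  ∈-resp-≈ : ∀ {gs} {π ρ : Perm n} → π ≈ ρ → π ∈⟨ gs ⟩ → ρ ∈⟨ gs ⟩
  ∈-resp-≈ p π∈ = mul {τ = idₚ} π∈ (one λ _ → refl) λ i → sym (p i)

  unique-lookup : ∀ {xs : List (Perm n)} → Unique (Group.setoid (Sym n)) xs →
    ∀ i j → lookup xs i ≈ lookup xs j → i ≡ j
  unique-lookup (u ∷ us) zero    zero    p = refl
  unique-lookup (u ∷ us) zero    (suc j) p = contradiction p (All.lookup u (∈-lookup j))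
  unique-lookup (u ∷ us) (suc i) zero    p = contradiction (λ i → sym (p i)) (All.lookup u (∈-lookup i))
  unique-lookup (u ∷ us) (suc i) (suc j) p = cong suc (unique-lookup us i j p)

  -- Bounds both the enumeration of G at every stage and the number of prescribed values by the
  -- order of the group.
  unique-length : ∀ {gs k} {xs : List (Perm n)} → HasOrder ⟨ gs ⟩ k →
    Unique (Group.setoid (Sym n)) xs → All (_∈⟨ gs ⟩) xs → length xs ≤ k
  unique-length {gs} {xs = xs} order unique xs⊆ = injective⇒≤ λ {i} {j} p →
    unique-lookup unique i j (Injection.injective (Inverse⇒Injection order) {element i} {element j} p)
    where
    element : ∀ i → Group.Carrier ⟨ gs ⟩
    element i = lookup xs i , All.lookup xs⊆ (∈-lookup i)

-- The iterates of a return to a; the iterate just before the return is a preimage.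
injective⇒surjective : ∀ {k} (f : Fin k → Fin k) → (∀ {a b} → f a ≡ f b → a ≡ b) → ∀ a → ∃[ b ] f b ≡ a
injective⇒surjective {k} f f-injective a =
  let i , j , i<j , p = pigeonhole ≤-refl (λ i → iterate f (toℕ {suc k} i) a)
  in descend (toℕ i) (toℕ j) i<j p
  where
  descend : ∀ i j → i < j → iterate f i a ≡ iterate f j a → ∃[ b ] f b ≡ a
  descend zero    (suc j) _         p = iterate f j a , sym (trans p (iterate-suc f j a))
  descend (suc i) (suc j) (s≤s i<j) p = descend i j i<j
    (f-injective (trans (sym (iterate-suc f i a)) (trans p (iterate-suc f j a))))

module Elements {n : ℕ} {gs : List (Perm n)} (es : List (Perm n))
  (unique : Unique (Group.setoid (Sym n)) es)
  (es⊆ : All (_∈⟨ gs ⟩) es)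
  (id∈ : Any (_≈ idₚ) es)
  (closed : ∀ {a g} → a ∈ es → g ∈ gs → Any (_≈ a ∘ₚ g) es) where

  el : Fin (length es) → Perm n
  el = lookup es

  el∈ : ∀ a → el a ∈⟨ gs ⟩
  el∈ a = All.lookup es⊆ (∈-lookup a)

  el-injective : ∀ {a b} → el a ≈ el b → a ≡ b
  el-injective = unique-lookup unique _ _

  position : ∀ π → Any (_≈ π) es → ∃[ a ] el a ≈ π
  position π h = Any.index h , lookup-index h

  -- Inverses come for free: right multiplication by ρ is an injective self-map of a finite list,
  -- hence onto, and a preimage is the product with the inverse.
  closed-under : ∀ {π} → π ∈⟨ gs ⟩ → ∀ a → ∃[ b ] el b ≈ el a ∘ₚ π
  closed-under {π} (gen g∈) a = position (el a ∘ₚ π) (closed (∈-lookup a) g∈)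
  closed-under (one p)  a = a , λ i → sym (p (el a ⟨$⟩ʳ i))
  closed-under {π} (mul {ρ} {τ} ρ∈ τ∈ p) a =
    let b , q = closed-under ρ∈ a
        c , r = closed-under τ∈ b
    in c , λ i → trans (r i) (trans (cong (τ ⟨$⟩ʳ_) (q i)) (sym (p (el a ⟨$⟩ʳ i))))
  closed-under {π} (inv {ρ} ρ∈ p) a =
    let b , q = injective⇒surjective step step-injective a
    in b , λ i → sym (undo b q i)
    where
    step : Fin (length es) → Fin (length es)
    step a = proj₁ (closed-under ρ∈ a)
    el-step : ∀ a → el (step a) ≈ el a ∘ₚ ρ
    el-step a = proj₂ (closed-under ρ∈ a)
    step-injective : ∀ {a b} → step a ≡ step b → a ≡ b
    step-injective {a} {b} eq = el-injective λ i → Injection.injective (Inverse⇒Injection ρ)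
      (trans (sym (el-step a i)) (trans (cong (λ c → el c ⟨$⟩ʳ i) eq) (el-step b i)))
    undo : ∀ b → step b ≡ a → ∀ i → π ⟨$⟩ʳ (el a ⟨$⟩ʳ i) ≡ el b ⟨$⟩ʳ i
    undo b refl i = trans (p _) (trans (cong (ρ ⟨$⟩ˡ_) (el-step b i)) (inverseˡ ρ))

  private
    e₀ : Fin (length es)
    e₀ = proj₁ (position idₚ id∈)

  -- Junk value e₀ outside the group.
  index : Perm n → Fin (length es)
  index π with any? (λ a → el a ≈? π)
  ... | yes (a , _) = a
  ... | no _        = e₀

  el-index : ∀ {π} → π ∈⟨ gs ⟩ → el (index π) ≈ π
  el-index {π} π∈ with any? (λ a → el a ≈? π)
  ... | yes (_ , p) = p
  ... | no ¬p       = contradiction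
    (proj₁ (closed-under π∈ e₀) , λ i →
      trans (proj₂ (closed-under π∈ e₀) i) (cong (π ⟨$⟩ʳ_) (proj₂ (position idₚ id∈) i))) ¬p

  infixl 7 _·_

  _·_ : Fin (length es) → Fin (length es) → Fin (length es)
  a · b = index (el a ∘ₚ el b)

  ε : Fin (length es)
  ε = index idₚ

  _⁻¹ : Fin (length es) → Fin (length es)
  a ⁻¹ = index (flip (el a))

  el-· : ∀ a b → el (a · b) ≈ el a ∘ₚ el b
  el-· a b = el-index (mul (el∈ a) (el∈ b) λ _ → refl)

  el-ε : el ε ≈ idₚ
  el-ε = el-index (one λ _ → refl)

  el-⁻¹ : ∀ a → el (a ⁻¹) ≈ flip (el a)
  el-⁻¹ a = el-index (inv (el∈ a) λ _ → refl)

  index-unique : ∀ {π a} → el a ≈ π → index π ≡ a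
  index-unique {π} {a} p = el-injective λ i → trans (el-index (∈-resp-≈ p (el∈ a)) i) (sym (p i))

  isGroup : IsGroup _≡_ _·_ ε _⁻¹
  isGroup = record
    { isMonoid = record
      { isSemigroup = record
        { isMagma = record { isEquivalence = isEquivalence ; ∙-cong = cong₂ _·_ }
        ; assoc = λ a b c → el-injective λ i → trans (el-· (a · b) c i)
            (trans (cong (el c ⟨$⟩ʳ_) (el-· a b i)) (sym (trans (el-· a (b · c) i) (el-· b c _))))
        }
      ; identity =
          (λ a → el-injective λ i → trans (el-· ε a i) (cong (el a ⟨$⟩ʳ_) (el-ε i))) ,
          (λ a → el-injective λ i → trans (el-· a ε i) (el-ε _))
      }
    ; inverse =
        (λ a → el-injective λ i → trans (el-· (a ⁻¹) a i)
          (trans (cong (el a ⟨$⟩ʳ_) (el-⁻¹ a i)) (trans (inverseʳ (el a)) (sym (el-ε i))))) ,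
        (λ a → el-injective λ i → trans (el-· a (a ⁻¹) i)
          (trans (el-⁻¹ a _) (trans (inverseˡ (el a)) (sym (el-ε i)))))
    ; ⁻¹-cong = cong _⁻¹
    }

-- Solutions correspond to actions

module Correspondence (I : HomExtSymInstance)
  (es : List (Perm (HomExtSymInstance.n I)))
  (unique : Unique (Group.setoid (Sym (HomExtSymInstance.n I))) es)
  (es⊆ : All (_∈⟨ HomExtSymInstance.gens I ⟩) es)
  (id∈ : Any (_≈ idₚ) es)
  (closed : ∀ {a g} → a ∈ es → g ∈ HomExtSymInstance.gens I → Any (_≈ a ∘ₚ g) es) where

  open HomExtSymInstance I
  open Elements es unique es⊆ id∈ closed public

  Γ : List (Fin (length es) × Perm m)
  Γ = map (λ (x , y) → index x , y) γ

  open Actions isGroup Γ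
  open GroupHomomorphism using (⟦⟧-cong; homo; ε-homo; ⁻¹-homo) renaming (⟦_⟧ to apply)

  -- In particular the value is independent of the proof of membership.
  ⟦⟧-resp : (H : Hom G (Sym m)) → ∀ {π ρ} (π∈ : π ∈⟨ gens ⟩) (ρ∈ : ρ ∈⟨ gens ⟩) → π ≈ ρ →
    apply H (π , π∈) ≈ apply H (ρ , ρ∈)
  ⟦⟧-resp H {π} {ρ} π∈ ρ∈ = ⟦⟧-cong H {π , π∈} {ρ , ρ∈}

  solution-action : HomExtSymSolution I → Action
  solution-action s = record
    { act   = λ p a → apply φ (el a , el∈ a) ⟨$⟩ʳ p
    ; act-ε = λ p → trans (⟦⟧-resp φ (el∈ ε) (one λ _ → refl) el-ε p) (ε-homo φ p)
    ; act-· = λ p a b → sym (trans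
        (⟦⟧-resp φ (el∈ (a · b)) (mul (el∈ a) (el∈ b) λ _ → refl) (el-· a b) p)
        (homo φ (el a , el∈ a) (el b , el∈ b) p))
    ; act-Γ = All.map⁺ (All.tabulate λ {(x , y)} xy∈ p →
        let x∈ = gen (∈-map⁺ proj₁ xy∈)
        in trans (⟦⟧-resp φ (el∈ (index x)) (proj₂ (inclusion (x , x∈)))
                    (el-index (All.lookup domγ⊆G xy∈)) p)
          (trans (φ|M≈ψ (x , x∈) p) (ψ-extendsγ xy∈ p)))
    }
    where open HomExtSymSolution s

  module _ (α : Action) where

    image : Perm n → Fin m → Fin m
    image π p = act α p (index π)

    image-cong : ∀ {π ρ} → π ∈⟨ gens ⟩ → π ≈ ρ → ∀ p → image π p ≡ image ρ p
    image-cong {π} {ρ} π∈ π≈ρ p = cong (act α p) (sym (index-unique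
      λ i → trans (el-index π∈ i) (π≈ρ i)))

    image-∘ : ∀ {π ρ} → π ∈⟨ gens ⟩ → ρ ∈⟨ gens ⟩ → ∀ p → image (π ∘ₚ ρ) p ≡ image ρ (image π p)
    image-∘ {π} {ρ} π∈ ρ∈ p = trans (cong (act α p) (index-unique λ i →
      trans (el-· (index π) (index ρ) i)
        (trans (cong (el (index ρ) ⟨$⟩ʳ_) (el-index π∈ i)) (el-index ρ∈ _))))
      (sym (act-· α p (index π) (index ρ)))

    image-id : ∀ {π} → π ∈⟨ gens ⟩ → π ≈ idₚ → ∀ p → image π p ≡ p
    image-id π∈ π≈id p = trans (image-cong π∈ π≈id p) (act-ε α p)

    flip∈ : ∀ {π} → π ∈⟨ gens ⟩ → flip π ∈⟨ gens ⟩
    flip∈ π∈ = inv π∈ λ _ → refl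

    image-flip : ∀ {π} → π ∈⟨ gens ⟩ → ∀ p → image (flip π) (image π p) ≡ p
    image-flip {π} π∈ p = trans (sym (image-∘ π∈ (flip∈ π∈) p))
      (image-id {π ∘ₚ flip π} (mul π∈ (flip∈ π∈) λ _ → refl) (λ _ → inverseˡ π) p)

    image-flip′ : ∀ {π} → π ∈⟨ gens ⟩ → ∀ p → image π (image (flip π) p) ≡ p
    image-flip′ {π} π∈ p = trans (sym (image-∘ (flip∈ π∈) π∈ p))
      (image-id {flip π ∘ₚ π} (mul (flip∈ π∈) π∈ λ _ → refl) (λ _ → inverseʳ π) p)

    hom : Hom G (Sym m)
    hom = record
      { ⟦_⟧ = λ (π , π∈) → permutation (image π) (image (flip π)) (image-flip′ π∈) (image-flip π∈)
      ; isGroupHomomorphism = record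
        { isMonoidHomomorphism = record
          { isMagmaHomomorphism = record
            { isRelHomomorphism = record { cong = λ {(π , π∈)} {_} π≈ρ → image-cong π∈ π≈ρ }
            ; homo = λ (π , π∈) (ρ , ρ∈) → image-∘ π∈ ρ∈
            }
          ; ε-homo = image-id {idₚ} (one λ _ → refl) (λ _ → refl)
          }
        ; ⁻¹-homo = λ _ _ → refl
        }
      }

    in-G : ∀ {π} → π ∈⟨ domγ ⟩ → π ∈⟨ gens ⟩
    in-G {π} π∈ = proj₂ (inclusion (π , π∈))

    -- Agreement on the domain of γ spreads to M by induction on the derivation of membership, both
    -- sides being homomorphisms.
    hom-extends : ∀ {π} (π∈ : π ∈⟨ domγ ⟩) → ∀ p → image π p ≡ apply ψ (π , π∈) ⟨$⟩ʳ p
    hom-extends (gen π∈) p with ∈-map⁻ proj₁ π∈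
    ... | (x , y) , xy∈ , refl = trans (All.lookup (All.map⁻ (act-Γ α)) xy∈ p)
      (trans (sym (ψ-extendsγ xy∈ p))
        (⟦⟧-cong ψ {x , gen (∈-map⁺ proj₁ xy∈)} {x , gen π∈} (λ _ → refl) p))
    hom-extends {π} (one π≈) p = trans (image-id {π} (one π≈) π≈ p)
      (sym (trans (⟦⟧-cong ψ {π , one π≈} {idₚ , one λ _ → refl} π≈ p) (ε-homo ψ p)))
    hom-extends {π} (mul {ρ} {τ} ρ∈ τ∈ π≈) p = begin
      image π p                                           ≡⟨ image-cong (in-G (mul ρ∈ τ∈ π≈)) π≈ p ⟩
      image (ρ ∘ₚ τ) p                                    ≡⟨ image-∘ (in-G ρ∈) (in-G τ∈) p ⟩
      image τ (image ρ p)                                 ≡⟨ hom-extends τ∈ (image ρ p) ⟩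
      apply ψ (τ , τ∈) ⟨$⟩ʳ image ρ p                        ≡⟨ cong (apply ψ (τ , τ∈) ⟨$⟩ʳ_) (hom-extends ρ∈ p) ⟩
      apply ψ (τ , τ∈) ⟨$⟩ʳ (apply ψ (ρ , ρ∈) ⟨$⟩ʳ p)          ≡⟨ homo ψ (ρ , ρ∈) (τ , τ∈) p ⟨
      apply ψ (ρ ∘ₚ τ , mul ρ∈ τ∈ λ _ → refl) ⟨$⟩ʳ p
        ≡⟨ ⟦⟧-cong ψ {π , mul ρ∈ τ∈ π≈} {ρ ∘ₚ τ , mul ρ∈ τ∈ λ _ → refl} π≈ p ⟨
      apply ψ (π , mul ρ∈ τ∈ π≈) ⟨$⟩ʳ p                      ∎
      where
      open ≡-Reasoning
    hom-extends {π} (inv {ρ} ρ∈ π≈) p = begin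
      image π p                                           ≡⟨ image-cong (in-G (inv ρ∈ π≈)) π≈ p ⟩
      image (flip ρ) p                                    ≡⟨ inverseˡ ψρ ⟨
      ψρ ⟨$⟩ˡ (ψρ ⟨$⟩ʳ image (flip ρ) p)                   ≡⟨ cong (ψρ ⟨$⟩ˡ_) (hom-extends ρ∈ _) ⟨
      ψρ ⟨$⟩ˡ image ρ (image (flip ρ) p)                  ≡⟨ cong (ψρ ⟨$⟩ˡ_) (image-flip′ (in-G ρ∈) p) ⟩
      ψρ ⟨$⟩ˡ p                                           ≡⟨ ⁻¹-homo ψ (ρ , ρ∈) p ⟨
      apply ψ (flip ρ , inv ρ∈ λ _ → refl) ⟨$⟩ʳ p
        ≡⟨ ⟦⟧-cong ψ {π , inv ρ∈ π≈} {flip ρ , inv ρ∈ λ _ → refl} π≈ p ⟨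
      apply ψ (π , inv ρ∈ π≈) ⟨$⟩ʳ p                         ∎
      where
      open ≡-Reasoning
      ψρ : Perm m
      ψρ = apply ψ (ρ , ρ∈)

    action-solution : HomExtSymSolution I
    action-solution = record { φ = hom ; φ|M≈ψ = λ (π , π∈) → hom-extends π∈ }

-- Reduction to the search

-- The second argument is evaluated under the binder of `collect`, with one more entry in front;
-- thus `compose v1 v1` multiplies the entries v1 and v0.
compose : Tm → Tm → Tm
compose e f = collect e (nth f v0)

-- Both run in the environment elements ∙ points of S_n ∙ input.
missing extend : Tm
missing = first v0 (first v5 (cond
  (first v3 (every v5 (equal (nth v1 v0) (nth v2 v0))))
  (const nil) (const nil & v0) ⊙ (compose v1 v1 & this)))
extend  = cond v0 ((snd ⊙ v0 & v1) & snd ⊙ snd) snd ⊙ (missing & this)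

indices : ℕ → Tree
indices k = tab {k} num

locate prepare answer solve : ℕ → Tm
locate k  = snd ⊙ first (const (indices k))
  (cond (every v3 (equal (nth (nth v3 v1) v0) (nth v2 v0))) (const nil & v0) (const nil))
prepare k =
  const (indices k) &
  range v3 &
  collect (const (indices k)) (collect (const (indices k))
    (locate k ⊙ (compose (nth v2 v0) (nth v3 v2) & snd ⊙ snd))) &
  collect (snd ⊙ snd ⊙ snd ⊙ snd ⊙ snd) (locate k ⊙ (fst ⊙ v0 & snd) & snd ⊙ v0) &
  const nil
answer k  = collect v6
  (collect (fst ⊙ snd ⊙ v3) ((snd ⊙ moves) ⊙ (v0 & v1 & snd ⊙ v3 & v4)) ⊙
   (locate k ⊙ (v0 & snd ⊙ snd ⊙ snd) & this))
solve k   =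
  cond v0 (const nil & answer k) (const nil) ⊙
  (search k (map block (functions k k)) ⊙ (const nil & v0) & this) ⊙
  (prepare k & this)

-- The nesting of loops in solve k depends on the order k, known only at run time.
dispatch : ℕ → ℕ → Tm
dispatch zero    k = const nil
dispatch (suc j) k = cond v0 (dispatch j (suc k) ⊙ (snd ⊙ v0 & snd)) (solve k ⊙ snd)

-- The list computed by `range v0` serves twice: as the points of S_n and as the encoding of the
-- identity, with which the enumeration starts.
main : ℕ → Tm
main B = dispatch (suc B) 0 ⊙ (v0 & this) ⊙ iter extend ⊙ ((v0 & const nil) & this) ⊙ (range v0 & this)

dispatch-eval : ∀ N j k ys η → length ys < j →
  eval N (dispatch j k) (list ys ∙ η) ≡ eval N (solve (k + length ys)) η
dispatch-eval N (suc j) k []       η _       = cong (λ k → eval N (solve k) η) (sym (+-identityʳ k))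
dispatch-eval N (suc j) k (_ ∷ ys) η (s≤s p) = trans (dispatch-eval N j (suc k) ys η p)
  (cong (λ k → eval N (solve k) η) (sym (+-suc k (length ys))))

encode-mapWith∈ : {A B : Set} {enc : B → Tree} {h : A → Tree} (xs : List A) {f : ∀ {x} → x ∈ xs → B} →
  (∀ {x} (x∈ : x ∈ xs) → h x ≡ enc (f x∈)) → list (map h xs) ≡ encodeList enc (mapWith∈ xs f)
encode-mapWith∈ []       p = refl
encode-mapWith∈ (x ∷ xs) p = cong₂ _∙_ (p (here refl)) (encode-mapWith∈ xs (p ∘ there))

-- Correctness of the reduction

module Reduction (N : ℕ) (I : HomExtSymInstance) {k : ℕ}
  (order : HasOrder (HomExtSymInstance.G I) k)
  (n≤N : HomExtSymInstance.n I ≤ N) (m<N : HomExtSymInstance.m I < N) (k≤N : k ≤ N)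
  (gens≤N : length (HomExtSymInstance.gens I) ≤ N) where

  open HomExtSymInstance I
  open Eval N
  open SearchProblem HomExtSym using (Correct; encodeSolution; encode)

  rest : Tree
  rest = tab {n} num ∙ encode I

  perms : List (Perm n) → Tree
  perms = list ∘ map encodePerm

  gens-value : ∀ {e x} → Value e x (encodeList encodePerm gens) → Value e x (perms gens)
  gens-value p = p ⟶ encodeList-list encodePerm gens

  compose-value : ∀ {e f x} (π ρ : Perm n) → Value e x (encodePerm π) →
    (∀ i → Value f (i ∙ x) (encodePerm ρ)) → Value (compose e f) x (encodePerm (π ∘ₚ ρ))
  compose-value π ρ p q = collect-value-Fin (perm-value π p) n≤N
    (λ i → nth-value (π ⟨$⟩ʳ i) (perm-value ρ (q _)) (val refl) n≤N)
    ⟶ sym (encodePerm-tab (π ∘ₚ ρ))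

  agree-decides : ∀ {r e f x} (π ρ : Perm n) → Value r x (tab {n} num) →
    (∀ i → Value e (i ∙ x) (encodePerm π)) → (∀ i → Value f (i ∙ x) (encodePerm ρ)) →
    Decides (every r (equal (nth e v0) (nth f v0))) x (π ≈ ρ)
  agree-decides π ρ r p q = every-decides-Fin r n≤N λ i →
    equal-decides (π ⟨$⟩ʳ i) (ρ ⟨$⟩ʳ i) (nth-value i (perm-value π (p _)) (val refl) n≤N)
      (nth-value i (perm-value ρ (q _)) (val refl) n≤N) n≤N

  record Partial (es : List (Perm n)) : Set where
    constructor partial
    field
      unique : Unique (Group.setoid (Sym n)) es
      es⊆    : All (_∈⟨ gens ⟩) es
      id∈    : Any (_≈ idₚ) es

    es≤k : length es ≤ k
    es≤k = unique-length order unique es⊆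

  Closed : List (Perm n) → Set
  Closed es = ∀ {a g} → a ∈ es → g ∈ gens → Any (_≈ a ∘ₚ g) es

  -- Failure gives only the double negation of closedness; decidability of membership in es up to
  -- `≈` removes it afterwards.
  missing-result : ∀ {es} → Partial es → Result missing (perms es ∙ rest)
    (λ v → ∃[ π ] v ≡ encodePerm π × Partial (π ∷ es)) (¬ Closed es)
  missing-result {es} part@(partial unique es⊆ id∈) = map-result new closed
    (first-result encodePerm es (val refl) es≤N λ a →
      first-result encodePerm gens (gens-value (val refl)) gens≤N λ g →
        ⊙-result (&-value (compose-value a g (val refl) (λ _ → val refl)) (val refl))
          (cond-result
            (first-result encodePerm es (val refl) es≤N λ b →
              agree-decides b (a ∘ₚ g) (val refl) (λ _ → val refl) (λ _ → val refl))
            (λ known → nil-result λ unknown → unknown known)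
            (λ unknown → res (found (refl , unknown)))))
    where
    es≤N : length es ≤ N
    es≤N = ≤-trans (Partial.es≤k part) k≤N
    Unknown : Perm n → Perm n → Set
    Unknown a g = ¬ Any (_≈ a ∘ₚ g) es
    new : ∀ {v} → Any (λ a → Any (λ g → v ≡ encodePerm (a ∘ₚ g) × Unknown a g) gens) es →
      ∃[ π ] v ≡ encodePerm π × Partial (π ∷ es)
    new h with find h
    ... | a , a∈ , h′ with find h′
    ... | g , g∈ , eq , ¬known = a ∘ₚ g , eq , partial
      (All.map (λ ¬p p → ¬p (λ i → sym (p i))) (¬Any⇒All¬ es ¬known) ∷ unique)
      (mul (All.lookup es⊆ a∈) (gen g∈) (λ _ → refl) ∷ es⊆)
      (there id∈)
    closed : ¬ Closed es → Any (λ a → Any (λ g → Unknown a g) gens) es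
    closed ¬c = decidable-stable (Any.any? (λ a → Any.any? (λ g → ¬? (Any.any? (_≈? (a ∘ₚ g)) es)) gens) es)
      λ ¬h → ¬c λ {a} {g} a∈ g∈ → decidable-stable (Any.any? (_≈? (a ∘ₚ g)) es)
        λ ¬known → ¬h (lose a∈ (lose g∈ ¬known))

  -- Every round that is not yet closed adds a new element, and no list of distinct elements exceeds
  -- the order k, so the clock suffices.
  closure : ∀ j es → Partial es → k < j + length es →
    ∃[ es′ ] iterate (eval N extend) j (perms es ∙ rest) ≡ perms es′ ∙ rest × Partial es′ × Closed es′
  closure zero    es part k< = contradiction k< (≤⇒≯ (Partial.es≤k part))
  closure (suc j) es part k< = go _ refl (outcome (missing-result part))
    where
    grow : Tree → Tree
    grow r = choose r ((tail r ∙ perms es) ∙ rest) (perms es ∙ rest)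
    go : ∀ r → eval N missing (perms es ∙ rest) ≡ r →
      Outcome (λ v → ∃[ π ] v ≡ encodePerm π × Partial (π ∷ es)) (¬ Closed es) r →
      ∃[ es′ ] iterate (eval N extend) j (grow r) ≡ perms es′ ∙ rest × Partial es′ × Closed es′
    go _ _ (found (π , refl , part′)) = closure j (π ∷ es) part′ (subst (k <_) (sym (+-suc j (length es))) k<)
    go _ eq (none ¬¬c) = es , stay j , part , λ {a} {g} a∈ g∈ →
      decidable-stable (Any.any? (_≈? (a ∘ₚ g)) es) λ ¬known → ¬¬c λ c → ¬known (c a∈ g∈)
      where
      stay : ∀ j → iterate (eval N extend) j (perms es ∙ rest) ≡ perms es ∙ rest
      stay zero    = refl
      stay (suc j) = trans (cong (iterate (eval N extend) j ∘ grow) eq) (stay j)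

  module Solve {es : List (Perm n)} (part : Partial es) (closed : Closed es) where

    open Partial part
    open Correspondence I es unique es⊆ id∈ closed

    K : ℕ
    K = length es

    K≤N : K ≤ N
    K≤N = ≤-trans es≤k k≤N

    γ≤N : length Γ ≤ N
    γ≤N = subst (_≤ N) (trans (length-map proj₁ γ) (sym (length-map _ γ)))
      (≤-trans (unique-length order γ-unique (All.map⁺ domγ⊆G)) k≤N)

    open Search N K≤N m<N isGroup Γ γ≤N
    open Actions isGroup Γ

    η : Tree
    η = perms es ∙ rest

    perms-value : ∀ {e x} → Value e x (perms es) → Value e x (tab (encodePerm ∘ el))
    perms-value p = p ⟶ cong list (trans (cong (map encodePerm) (sym (tabulate-lookup es)))
                                         (map-tabulate (lookup es) encodePerm))

    el-value : ∀ {e f x} a → Value e x (perms es) → Value f x (num a) → Value (nth e f) x (encodePerm (el a))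
    el-value a p q = nth-value a (perms-value p) q K≤N

    locate-value : ∀ π → π ∈⟨ gens ⟩ → Value (locate K) (encodePerm π ∙ η) (num (index π))
    locate-value π π∈ = val (go (outcome located))
      where
      located : Result (first (const (indices K))
          (cond (every v3 (equal (nth (nth v3 v1) v0) (nth v2 v0))) (const nil & v0) (const nil)))
        (encodePerm π ∙ η) (λ v → ∃[ a ] v ≡ num a × el a ≈ π) (∃[ a ] el a ≈ π)
      located = first-result-Fin {enc = num} (val refl) K≤N λ a → cond-result
        (agree-decides (el a) π (val refl) (λ _ → el-value a (val refl) (val refl)) (λ _ → val refl))
        (λ p → res (found (refl , p))) nil-result
      go : ∀ {t} → Outcome (λ v → ∃[ a ] v ≡ num a × el a ≈ π) (∃[ a ] el a ≈ π) t → tail t ≡ num (index π)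
      go (found (a , refl , p)) = cong num (sym (index-unique p))
      go (none ¬p)              = contradiction (index π , el-index π∈) ¬p

    prepare-value : Value (prepare K) η ρ
    prepare-value =
      &-value (val refl) (&-value (range-value m (val refl) (<⇒≤ m<N)) (&-value
        (collect-value-Fin {enc = num} (val refl) K≤N λ d → collect-value-Fin {enc = num} (val refl) K≤N λ a →
          ⊙-value (&-value (compose-value (el a) (el d) (el-value a (val refl) (val refl))
                              (λ _ → el-value d (val refl) (val refl))) (val refl))
            (locate-value (el a ∘ₚ el d) (mul (el∈ a) (el∈ d) λ _ → refl)))
        (&-value
          (collect-value (λ (x , y) → encodePerm x ∙ encodePerm y) γ (val (encodeList-list _ γ))
            (subst (_≤ N) (length-map _ γ) γ≤N)
            (λ {(x , y)} xy∈ → &-value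
              (⊙-value (val refl) (locate-value x (All.lookup domγ⊆G xy∈))) (val refl))
            ⟶ cong list (map-∘ γ))
          (val refl))))

    action-value : ∀ {s} (good : Good s) (full : ∀ p → Used s p) p x →
      Value (snd ⊙ moves) (num p ∙ num x ∙ state s ∙ ρ) (num (act (action good full) p x))
    action-value {s} good full p x = val (go (outcome (moves-result good p x)))
      where
      go : ∀ {t} → Outcome (λ v → ∃[ q ] v ≡ num q × Moves s p x q) (Used s p) t →
        tail t ≡ num (act (action good full) p x)
      go (found (q , refl , mv)) = cong num (moves-action good full mv)
      go (none ¬u)               = contradiction (full p) ¬u

    answer-value : ∀ {s u} (good : Good s) (full : ∀ p → Used s p) →
      Value (answer K) ((u ∙ state s) ∙ ρ ∙ η)
        (encodeSolution I (action-solution (action good full)))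
    answer-value {s} good full =
      collect-value encodePerm gens (gens-value (val refl)) gens≤N
        (λ {g} g∈ → ⊙-value (&-value (⊙-value (val refl) (locate-value g (gen g∈))) (val refl))
          (collect-value-Fin {enc = num} {g = λ p → num (act (action good full) p (index g))}
            (val refl) (<⇒≤ m<N) λ p →
            ⊙-value (val refl) (action-value good full p (index g))))
      ⟶ encode-mapWith∈ gens λ g∈ →
        sym (encodePerm-tab (GroupHomomorphism.⟦_⟧ (hom (action good full)) (_ , gen g∈)))

    -- When the search fails there is no solution: its action would satisfy the invariant for the
    -- empty list of blocks, as `functions K K` represents every kernel.
    solve-correct : Correct I (eval N (solve K) η)
    solve-correct = subst (λ r → Correct I (finish (eval N (search K kernels) (nil ∙ r) ∙ r ∙ η)))
      (sym (value prepare-value)) (go (outcome (search-result (functions K K) [])))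
      where
      kernels : List Tree
      kernels = map block (functions K K)
      finish : Tree → Tree
      finish = eval N (cond v0 (const nil & answer K) (const nil))
      go : ∀ {t} → Outcome Complete (Extends [] (functions K K)) t → Correct I (finish (t ∙ ρ ∙ η))
      go (found (s , refl , good , full)) = inj₂ (action-solution (action good full) ,
        cong (nil ∙_) (value (answer-value good full)))
      go (none ¬E) = inj₁ (refl , λ s → ¬E
        (extends (solution-action s) [] λ p _ → kernels-complete (act (solution-action s) p)))

  start : Partial (idₚ ∷ [])
  start = partial ([] ∷ []) (one (λ _ → refl) ∷ []) (here λ _ → refl)

  main-correct : ∀ {B} → k ≤ B → Correct I (eval N (main B) (encode I))
  main-correct {B} k≤B with closure N (idₚ ∷ []) start (subst (k <_) (sym (+-comm N 1)) (s≤s k≤N))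
  ... | es , eq , part , closed = subst (Correct I) (sym (begin
    finish (eval N (range v0) (encode I))
      ≡⟨ cong finish (value (range-value {v0} {encode I} n (val refl) n≤N)) ⟩
    finish (tab {n} num)
      ≡⟨ cong (λ t → last (iterate (eval N extend) N ((t ∙ nil) ∙ rest))) (encodePerm-tab {n} idₚ) ⟨
    last (iterate (eval N extend) N (perms (idₚ ∷ []) ∙ rest))
      ≡⟨ cong last eq ⟩
    last (perms es ∙ rest)
      ≡⟨ dispatch-eval N (suc B) 0 (map encodePerm es) (perms es ∙ rest)
           (s≤s (subst (_≤ B) (sym (length-map encodePerm es)) (≤-trans (Partial.es≤k part) k≤B))) ⟩
    eval N (solve (length (map encodePerm es))) (perms es ∙ rest)
      ≡⟨ cong (λ j → eval N (solve j) (perms es ∙ rest)) (length-map encodePerm es) ⟩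
    eval N (solve (length es)) (perms es ∙ rest) ∎))
    (Solve.solve-correct part closed)
    where
    open ≡-Reasoning
    last finish : Tree → Tree
    last η   = eval N (dispatch (suc B) 0) (head η ∙ η)
    finish r = last (iterate (eval N extend) N ((r ∙ nil) ∙ r ∙ encode I))

solvable : (Q : HomExtSymInstance → Set) (B : ℕ) (e : Tm) →
  (∀ I → Q I → SearchProblem.Correct HomExtSym I
    (eval (fuel B (HomExtSymInstance.n I) (HomExtSymInstance.m I)) e (SearchProblem.encode HomExtSym I))) →
  SolvableInPolynomialTime (HomExtSym restrictedTo Q)
solvable Q B e correct =
  let c , d , run = program-correct B e
  in program B e , c , d , λ (I , q) →
  let open HomExtSymInstance I
      t , p , t≤ = run n m _ {{m-positive}}
  in _ , t , p , t≤ , correct I q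

theorem1p7 : (B : ℕ) → SolvableInPolynomialTime (HomExtSym restrictedTo GroupOrderAtMost B)
-- The clock is set for `suc B` rather than B, so that it exceeds m strictly even for B = 0.
theorem1p7 B = solvable (GroupOrderAtMost B) (suc B) (main B) λ I (k , order , k≤B) →
  let open HomExtSymInstance I
      N = fuel (suc B) n m
      doubled≤N : n * 2 ≤ N
      doubled≤N = ≤-trans (m≤m+n (n * 2) (suc B)) (m≤n+m (n * 2 + suc B) m)
  in Reduction.main-correct N I order
       (≤-trans (m≤m*n n 2) doubled≤N)
       (≤-trans (≤-reflexive (+-comm 1 m)) (+-monoʳ-≤ m (≤-trans (s≤s z≤n) (m≤n+m (suc B) (n * 2)))))
       (≤-trans k≤B (≤-trans (n≤1+n B) (≤-trans (m≤n+m (suc B) (n * 2)) (m≤n+m (n * 2 + suc B) m))))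
       (≤-trans few-gens (≤-trans (≤-reflexive (*-comm 2 n)) doubled≤N))
       k≤B
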